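{- Let $p$ be an odd prime, and let $g$ be a positive integer with $g\mid p-1$. Then $$G(g,p-1)\le \frac{p(p-1)}{g}-\left\lceil \frac{3p-1-g}{2g}\right\rceil.$$ In particular, for fixed $g$, $$G(g,p-1)\le \frac{p(p-1)}{g}-\frac{3p}{2g}+O_g(1),$$ where $p$ ranges over odd primes with $g\mid p-1$ and $O_g(1)$ denotes a quantity bounded in absolute value by a constant depending only on $g$.
   Context: A finite set $\mathcal{G}\subset\mathbb{Z}$ is a $g$-Golomb ruler if for every positive integer $d$ the number of pairs $(a,c)\in \mathcal{G}^2$ with $c-a=d$ is at most $g$. $G(g,n)$ denotes the minimum possible diameter (largest element minus smallest element) of a $g$-Golomb ruler with exactly $n$ elements (marks). -}

module Defs where

open import Data.Fin.Base using (Fin; toℕ; fromℕ<)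
open import Data.Fin.Properties using (any?; toℕ<n; toℕ-fromℕ<)
open import Data.Integer.Base as ℤ using (ℤ; +_; 0ℤ)
import Data.Integer.Properties as ℤ
open import Data.Integer.Tactic.RingSolver using (solve-∀)
open import Data.List.Base
  using (List; []; _∷_; length; map; _++_; filter; cartesianProduct)
open import Data.List.Membership.Propositional using (_∈_)
open import Data.List.Membership.Propositional.Properties
  using (∈-filter⁻; ∈-cartesianProduct⁻; ∈-map⁺; ∈-map⁻)
import Data.List.Membership.DecPropositional ℤ._≟_ as ∈Dec
import Data.List.Properties as List
open import Data.List.Relation.Unary.All as All using (All; []; _∷_)
import Data.List.Relation.Unary.All.Properties as All
open import Data.List.Relation.Unary.AllPairs using ([]; _∷_)
open import Data.List.Relation.Unary.Any using (here; there)
open import Data.List.Relation.Unary.Unique.Propositional using (Unique)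
import Data.List.Relation.Unary.Unique.Propositional.Properties as Unique
import Data.List.Relation.Unary.Unique.DecPropositional ℤ._≟_ as UniqueDec
open import Data.Nat.Base as ℕ
  using (ℕ; zero; suc; _+_; _∸_; _≤_; _<_; z≤n; s≤s; NonZero)
import Data.Nat.Properties as ℕ
open import Data.Nat.Primality using (Prime)
open import Data.Product.Base using (∃; _×_; _,_; proj₁; proj₂)
open import Data.Sum.Base using (_⊎_; inj₁; inj₂)
open import Function.Base using (_∘_; case_of_)
open import Relation.Binary.PropositionalEquality
open import Relation.Nullary.Decidable.Core
  using (Dec; yes; no; map′; _×-dec_; _→-dec_)
open import Relation.Nullary.Negation.Core using (¬_; contradiction)
open import Relation.Unary using (Pred; Decidable)
open import Level using (0ℓ)

-- Finite subsets of ℤ are duplicate-free lists, in no particular order.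

pairsAt : ℤ → List ℤ → List (ℤ × ℤ)
pairsAt d xs = filter (λ (a , c) → (c ℤ.- a) ℤ.≟ d) (cartesianProduct xs xs)

IsGolomb : ℕ → List ℤ → Set
IsGolomb g xs = ∀ d → 0ℤ ℤ.< d → length (pairsAt d xs) ≤ g

record HasDiameter (xs : List ℤ) (d : ℕ) : Set where
  field
    smallest largest : ℤ
    smallest∈        : smallest ∈ xs
    largest∈         : largest ∈ xs
    smallest≤        : All (smallest ℤ.≤_) xs
    ≤largest         : All (ℤ._≤ largest) xs
    difference       : largest ℤ.- smallest ≡ + d

record Ruler (g n d : ℕ) : Set where
  field
    marks    : List ℤ
    distinct : Unique marks
    size     : length marks ≡ n
    golomb   : IsGolomb g marks
    diameter : HasDiameter marks d

IsMinimumDiameter : (g n m : ℕ) → Set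
IsMinimumDiameter g n m = Ruler g n m × (∀ d → Ruler g n d → m ≤ d)

-- The remainder, up to `minimumDiameter`, shows that the minimum exists:
-- rulers of every nonzero size exist, and after translating the smallest
-- mark to 0 only finitely many candidates of a given diameter remain.

private

  least : {P : Pred ℕ 0ℓ} → Decidable P → ∃ P →
          ∃ λ m → P m × (∀ d → P d → m ≤ d)
  least {P} P? (k , pk) = case search (suc k) of λ where
      (inj₁ found) → found
      (inj₂ none)  → contradiction pk (none k ℕ.≤-refl)
    where
    search : ∀ k → (∃ λ m → P m × (∀ d → P d → m ≤ d)) ⊎
                   (∀ d → d < k → ¬ P d)
    search zero = inj₂ λ _ ()
    search (suc k) with search k
    ... | inj₁ found = inj₁ found
    ... | inj₂ none with P? k
    ...   | yes pk = inj₁ (k , pk , λ d pd → ℕ.≮⇒≥ λ d<k → none d d<k pd)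
    ...   | no ¬pk = inj₂ λ d d<1+k pd → case ℕ.m<1+n⇒m<n∨m≡n d<1+k of λ where
              (inj₁ d<k)  → none d d<k pd
              (inj₂ refl) → ¬pk pd

  length-filter-map :
    {A B : Set} {P : Pred A 0ℓ} {Q : Pred B 0ℓ}
    (P? : Decidable P) (Q? : Decidable Q) (h : A → B) →
    (∀ x → P x → Q (h x)) → (∀ x → Q (h x) → P x) →
    ∀ xs → length (filter Q? (map h xs)) ≡ length (filter P? xs)
  length-filter-map P? Q? h to from [] = refl
  length-filter-map P? Q? h to from (x ∷ xs) with P? x | Q? (h x)
  ... | yes _ | yes _ = cong suc (length-filter-map P? Q? h to from xs)
  ... | no _  | no _  = length-filter-map P? Q? h to from xs
  ... | yes p | no ¬q = contradiction (to x p) ¬q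
  ... | no ¬p | yes q = contradiction (from x q) ¬p

  cartesianProduct-map :
    {A B : Set} (f : A → B) (xs ys : List A) →
    cartesianProduct (map f xs) (map f ys) ≡
    map (λ (a , c) → f a , f c) (cartesianProduct xs ys)
  cartesianProduct-map f [] ys = refl
  cartesianProduct-map f (x ∷ xs) ys = trans
    (cong₂ _++_
      (trans (sym (List.map-∘ ys)) (List.map-∘ ys))
      (cartesianProduct-map f xs ys))
    (sym (List.map-++ _ (map (x ,_) ys) (cartesianProduct xs ys)))

  -‿cancel : ∀ s a c → (c ℤ.- s) ℤ.- (a ℤ.- s) ≡ c ℤ.- a
  -‿cancel = solve-∀

  -‿injectiveˡ : ∀ s {a c} → a ℤ.- s ≡ c ℤ.- s → a ≡ c
  -‿injectiveˡ s {a} {c} eq =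
    trans (restore a s) (trans (cong (λ z → z ℤ.+ s) eq) (sym (restore c s)))
    where
    restore : ∀ x s → x ≡ (x ℤ.- s) ℤ.+ s
    restore = solve-∀

  translate : ∀ g s xs → IsGolomb g xs → IsGolomb g (map (ℤ._- s) xs)
  translate g s xs golomb d d>0 = ℕ.≤-trans (ℕ.≤-reflexive count) (golomb d d>0)
    where
    count : length (pairsAt d (map (ℤ._- s) xs)) ≡ length (pairsAt d xs)
    count = trans
      (cong (length ∘ filter _) (cartesianProduct-map (ℤ._- s) xs xs))
      (length-filter-map _ _ (λ (a , c) → (a ℤ.- s) , (c ℤ.- s))
        (λ (a , c) → trans (-‿cancel s a c))
        (λ (a , c) → trans (sym (-‿cancel s a c)))
        (cartesianProduct xs xs))

  golomb? : ∀ g → Decidable (IsGolomb g)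
  golomb? g xs = map′ to from
    (All.all? (λ (a , c) → (0ℤ ℤ.<? (c ℤ.- a)) →-dec
                           (length (pairsAt (c ℤ.- a) xs) ℕ.≤? g))
              (cartesianProduct xs xs))
    where
    Bound : ℤ × ℤ → Set
    Bound (a , c) = 0ℤ ℤ.< c ℤ.- a → length (pairsAt (c ℤ.- a) xs) ≤ g

    to : All Bound (cartesianProduct xs xs) → IsGolomb g xs
    to bounds d d>0 = go (pairsAt d xs) refl
      where
      go : ∀ ps → pairsAt d xs ≡ ps → length ps ≤ g
      go [] _ = z≤n
      go (p ∷ ps) eq
        with ∈-filter⁻ (λ (a , c) → (c ℤ.- a) ℤ.≟ d)
               {xs = cartesianProduct xs xs} (subst (p ∈_) (sym eq) (here refl))
      ... | p∈ , refl =
        subst (λ qs → length qs ≤ g) eq (All.lookup bounds p∈ d>0)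

    from : IsGolomb g xs → All Bound (cartesianProduct xs xs)
    from golomb = All.tabulate λ {(a , c)} _ → golomb (c ℤ.- a)

  InRange : ℕ → ℤ → Set
  InRange d z = ∃ λ (i : Fin (suc d)) → z ≡ + toℕ i

  boundedList? : ∀ d n {P : Pred (List ℤ) 0ℓ} → Decidable P →
                 Dec (∃ λ xs → length xs ≡ n × All (InRange d) xs × P xs)
  boundedList? d zero P? =
    map′ (λ p → [] , refl , [] , p) (λ { ([] , _ , _ , p) → p }) (P? [])
  boundedList? d (suc n) P? =
    map′ (λ { (i , xs , refl , r , p) → + toℕ i ∷ xs , refl , (i , refl) ∷ r , p })
         (λ { (_ ∷ xs , refl , (i , refl) ∷ r , p) → i , xs , refl , r , p })
         (any? λ i → boundedList? d n (P? ∘ (+ toℕ i ∷_)))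

  Normal : ℕ → ℕ → List ℤ → Set
  Normal g d xs = Unique xs × IsGolomb g xs × 0ℤ ∈ xs × + d ∈ xs

  inRange : ∀ d z → 0ℤ ℤ.≤ z → z ℤ.≤ + d → InRange d z
  inRange d (+ k) _ (ℤ.+≤+ k≤d) =
    fromℕ< (s≤s k≤d) , cong +_ (sym (toℕ-fromℕ< (s≤s k≤d)))

  ruler? : ∀ g n → Decidable (Ruler g n)
  ruler? g n d = map′ to from (boundedList? d n λ xs →
      UniqueDec.unique? xs ×-dec golomb? g xs ×-dec
      (0ℤ ∈Dec.∈? xs) ×-dec (+ d ∈Dec.∈? xs))
    where
    to : (∃ λ xs → length xs ≡ n × All (InRange d) xs × Normal g d xs) → Ruler g n d
    to (xs , size , range , unique , golomb , 0∈ , d∈) = record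
      { marks = xs ; distinct = unique ; size = size ; golomb = golomb
      ; diameter = record
        { smallest = 0ℤ ; largest = + d ; smallest∈ = 0∈ ; largest∈ = d∈
        ; smallest≤ = All.map (λ { (i , refl) → ℤ.+≤+ z≤n }) range
        ; ≤largest = All.map (λ { (i , refl) → ℤ.+≤+ (ℕ.≤-pred (toℕ<n i)) }) range
        ; difference = ℤ.+-identityʳ (+ d) } }

    from : Ruler g n d → ∃ λ xs → length xs ≡ n × All (InRange d) xs × Normal g d xs
    from ruler = map (ℤ._- smallest) marks
      , trans (List.length-map _ marks) size
      , All.map⁺ (All.tabulate λ {z} z∈ → inRange d (z ℤ.- smallest)
          (ℤ.i≤j⇒0≤j-i (All.lookup smallest≤ z∈))
          (subst (z ℤ.- smallest ℤ.≤_) difference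
            (ℤ.+-monoˡ-≤ (ℤ.- smallest) (All.lookup ≤largest z∈))))
      , Unique.map⁺ (-‿injectiveˡ smallest) distinct
      , translate g smallest marks golomb
      , subst (_∈ map (ℤ._- smallest) marks) (ℤ.+-inverseʳ smallest) (∈-map⁺ (ℤ._- smallest) smallest∈)
      , subst (_∈ map (ℤ._- smallest) marks) difference (∈-map⁺ (ℤ._- smallest) largest∈)
      where
      open Ruler ruler
      open HasDiameter diameter

  -- Rulers with marks 0, 1, 3, 7, …: all positive differences are distinct.
  record Sidon (n : ℕ) : Set where
    field
      marks    : List ℕ
      top      : ℕ
      distinct : Unique marks
      size     : length marks ≡ n
      0∈       : 0 ∈ marks
      top∈     : top ∈ marks
      ≤top     : All (_≤ top) marks
      sidon    : ∀ {a c a′ c′} → a ∈ marks → c ∈ marks → a′ ∈ marks → c′ ∈ marks →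
                 a < c → a′ < c′ → c + a′ ≡ c′ + a → a ≡ a′ × c ≡ c′

  sidonRuler : ∀ n → Sidon (suc n)
  sidonRuler zero = record
    { marks = 0 ∷ [] ; top = 0 ; distinct = [] ∷ [] ; size = refl
    ; 0∈ = here refl ; top∈ = here refl ; ≤top = z≤n ∷ []
    ; sidon = λ { (here refl) (here refl) _ _ () } }
  sidonRuler (suc n) = record
    { marks = N ∷ marks
    ; top = N
    ; distinct = All.map (λ x≤M N≡x → ℕ.<⇒≱ M<N (subst (_≤ top) (sym N≡x) x≤M)) ≤top ∷ distinct
    ; size = cong suc size
    ; 0∈ = there 0∈
    ; top∈ = here refl
    ; ≤top = ≤N
    ; sidon = sidon′ }
    where
    open Sidon (sidonRuler n)
    N : ℕ
    N = suc (top + top)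

    M<N : top < N
    M<N = s≤s (ℕ.m≤m+n top top)

    ≤N : All (_≤ N) (N ∷ marks)
    ≤N = ℕ.≤-refl ∷ All.map (λ x≤M → ℕ.≤-trans x≤M (ℕ.<⇒≤ M<N)) ≤top

    clash : ∀ {a c b} → a ∈ marks → c ∈ marks → N + b ≢ c + a
    clash {a} {c} {b} a∈ c∈ eq = ℕ.<⇒≱ (ℕ.n<1+n (top + top)) (begin
      N         ≤⟨ ℕ.m≤m+n N b ⟩
      N + b     ≡⟨ eq ⟩
      c + a     ≤⟨ ℕ.+-mono-≤ (All.lookup ≤top c∈) (All.lookup ≤top a∈) ⟩
      top + top ∎)
      where
      open ℕ.≤-Reasoning

    sidon′ : ∀ {a c a′ c′} → a ∈ N ∷ marks → c ∈ N ∷ marks → a′ ∈ N ∷ marks → c′ ∈ N ∷ marks →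
             a < c → a′ < c′ → c + a′ ≡ c′ + a → a ≡ a′ × c ≡ c′
    sidon′ (here refl) c∈ _ _ a<c _ _ = contradiction (All.lookup ≤N c∈) (ℕ.<⇒≱ a<c)
    sidon′ (there _) _ (here refl) c′∈ _ a′<c′ _ = contradiction (All.lookup ≤N c′∈) (ℕ.<⇒≱ a′<c′)
    sidon′ (there _) (here refl) (there _) (here refl) _ _ eq =
      sym (ℕ.+-cancelˡ-≡ N _ _ eq) , refl
    sidon′ (there a∈) (here refl) (there _) (there c′∈) _ _ eq =
      contradiction eq (clash a∈ c′∈)
    sidon′ (there _) (there c∈) (there a′∈) (here refl) _ _ eq =
      contradiction (sym eq) (clash a′∈ c∈)
    sidon′ (there a∈) (there c∈) (there a′∈) (there c′∈) = sidon a∈ c∈ a′∈ c′∈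

  length≤1 : {A : Set} (xs : List A) → Unique xs →
             (∀ {x y} → x ∈ xs → y ∈ xs → x ≡ y) → length xs ≤ 1
  length≤1 [] _ _ = z≤n
  length≤1 (_ ∷ []) _ _ = s≤s z≤n
  length≤1 (_ ∷ _ ∷ _) ((x≢y ∷ _) ∷ _) all≡ =
    contradiction (all≡ (here refl) (there (here refl))) x≢y

  -≡⇒+≡ : ∀ a c a′ c′ → + c ℤ.- + a ≡ + c′ ℤ.- + a′ → c + a′ ≡ c′ + a
  -≡⇒+≡ a c a′ c′ eq = ℤ.+-injective (begin
    + c ℤ.+ + a′                          ≡⟨ regroup (+ c) (+ a′) (+ a) ⟩
    (+ c ℤ.- + a) ℤ.+ (+ a ℤ.+ + a′)      ≡⟨ cong (ℤ._+ (+ a ℤ.+ + a′)) eq ⟩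
    (+ c′ ℤ.- + a′) ℤ.+ (+ a ℤ.+ + a′)    ≡⟨ cong (λ z → (+ c′ ℤ.- + a′) ℤ.+ z) (ℤ.+-comm (+ a) (+ a′)) ⟩
    (+ c′ ℤ.- + a′) ℤ.+ (+ a′ ℤ.+ + a)    ≡⟨ regroup (+ c′) (+ a) (+ a′) ⟨
    + c′ ℤ.+ + a                          ∎)
    where
    open ≡-Reasoning
    regroup : ∀ x y z → x ℤ.+ y ≡ (x ℤ.- z) ℤ.+ (z ℤ.+ y)
    regroup = solve-∀

  0<-⇒< : ∀ a c → 0ℤ ℤ.< + c ℤ.- + a → a < c
  0<-⇒< a c 0<c-a = ℕ.≰⇒> λ c≤a →
    ℤ.<⇒≱ 0<c-a (ℤ.i≤j⇒i-j≤0 (ℤ.+≤+ c≤a))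

  sidon⇒ruler : ∀ {g n} .{{_ : NonZero g}} (S : Sidon n) → Ruler g n (Sidon.top S)
  sidon⇒ruler {g} S = record
    { marks = map +_ marks
    ; distinct = unique
    ; size = trans (List.length-map +_ marks) size
    ; golomb = λ d d>0 → ℕ.≤-trans
        (length≤1 (pairsAt d (map +_ marks))
          (Unique.filter⁺ _ (Unique.cartesianProduct⁺ unique unique))
          (same d d>0))
        (ℕ.>-nonZero⁻¹ g)
    ; diameter = record
      { smallest = 0ℤ ; largest = + top
      ; smallest∈ = ∈-map⁺ +_ 0∈ ; largest∈ = ∈-map⁺ +_ top∈
      ; smallest≤ = All.map⁺ (All.map (λ _ → ℤ.+≤+ z≤n) ≤top)
      ; ≤largest = All.map⁺ (All.map ℤ.+≤+ ≤top)
      ; difference = ℤ.+-identityʳ (+ top) } }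
    where
    open Sidon S
    unique : Unique (map +_ marks)
    unique = Unique.map⁺ ℤ.+-injective distinct

    unpack : ∀ d {p} → p ∈ pairsAt d (map +_ marks) →
             ∃ λ a → ∃ λ c → a ∈ marks × c ∈ marks × p ≡ (+ a , + c) × + c ℤ.- + a ≡ d
    unpack d p∈
      with p∈prod , eq ← ∈-filter⁻ (λ (a , c) → (c ℤ.- a) ℤ.≟ d) p∈
      with a∈ , c∈ ← ∈-cartesianProduct⁻ (map +_ marks) (map +_ marks) p∈prod
      with a , a∈′ , refl ← ∈-map⁻ +_ a∈
         | c , c∈′ , refl ← ∈-map⁻ +_ c∈ = a , c , a∈′ , c∈′ , refl , eq

    same : ∀ d → 0ℤ ℤ.< d → ∀ {p q} →
           p ∈ pairsAt d (map +_ marks) → q ∈ pairsAt d (map +_ marks) → p ≡ q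
    same d d>0 p∈ q∈
      with a , c , a∈ , c∈ , refl , eq ← unpack d p∈
         | a′ , c′ , a′∈ , c′∈ , refl , eq′ ← unpack d q∈
      with refl , refl ← sidon a∈ c∈ a′∈ c′∈
             (0<-⇒< a c (subst (0ℤ ℤ.<_) (sym eq) d>0))
             (0<-⇒< a′ c′ (subst (0ℤ ℤ.<_) (sym eq′) d>0))
             (-≡⇒+≡ a c a′ c′ (trans eq (sym eq′))) = refl

abstract
  minimumDiameter : ∀ g n .{{_ : NonZero g}} .{{_ : NonZero n}} →
                    ∃ (IsMinimumDiameter g n)
  minimumDiameter g (suc n) = least (ruler? g (suc n)) (_ , sidon⇒ruler (sidonRuler n))

G : ∀ g n .{{_ : NonZero g}} .{{_ : NonZero n}} → ℕ
G g n = proj₁ (minimumDiameter g n)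

G-isMinimumDiameter : ∀ g n .{{_ : NonZero g}} .{{_ : NonZero n}} →
                      IsMinimumDiameter g n (G g n)
G-isMinimumDiameter g n = proj₂ (minimumDiameter g n)

prime⇒p∸1≢0 : ∀ {p} → Prime p → NonZero (p ∸ 1)
prime⇒p∸1≢0 {suc (suc _)} _ = _

{-# OPTIONS --safe #-}

-- Let p = gk + 1 with primitive root θ and let aᵢ solve aᵢ ≡ i (mod p - 1),
-- aᵢ ≡ θⁱ (mod p) (Ruzsa). Modulo M = p(p - 1)/g = pk each nonzero t is a difference
-- of at most g pairs: i - j is known mod k, which leaves g values mod p - 1, and each of
-- them determines θʲ from θⁱ - θʲ ≡ t (mod p). Since the gaps between cyclically
-- consecutive residues are differences, each gap length occurs at most g times; as the
-- p - 1 gaps sum to M, the widest one has length L ≥ (3p - 1 - g)/(2g). Cutting the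
-- circle at that gap leaves an integer ruler of diameter M - L.
module Submission where

open import Defs
open import Data.Bool.Base using (true; false)
open import Data.Fin.Base as Fin using (Fin; zero; suc; toℕ; fromℕ; fromℕ<; inject₁)
import Data.Fin.Properties as Fin
open import Data.Integer.Base as ℤ using (ℤ; +_; 0ℤ; 1ℤ; -1ℤ)
open import Data.Integer.DivMod as ℤ using (_%ℕ_; _/ℕ_; n%ℕd<d; a≡a%ℕn+[a/ℕn]*n)
open import Data.Integer.Divisibility.Signed using (divides; ∣ᵤ⇒∣; ∣⇒∣ᵤ)
import Data.Integer.Properties as ℤ
open import Data.Integer.Tactic.RingSolver using (solve-∀)
open import Data.List.Base
  using (List; []; _∷_; length; lookup; map; filter; replicate; applyUpTo; upTo; concatMap;
         cartesianProduct)
open import Data.List.Extrema.Nat using (argmax; argmax-sel; f[xs]≤f[argmax])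
open import Data.List.Membership.Propositional using (_∈_; _∉_)
open import Data.List.Membership.Propositional.Properties
  using (∈-lookup; ∈-map⁺; ∈-map⁻; ∈-upTo⁺; ∈-upTo⁻; ∈-filter⁻; ∈-concatMap⁺;
         ∈-applyUpTo⁺; ∈-applyUpTo⁻; ∈-cartesianProduct⁻)
import Data.List.Properties as List
open import Data.List.Relation.Unary.All as All using (All; []; _∷_)
import Data.List.Relation.Unary.All.Properties as All
open import Data.List.Relation.Unary.AllPairs using (AllPairs; []; _∷_)
import Data.List.Relation.Unary.AllPairs.Properties as AllPairs
open import Data.List.Relation.Unary.Any as Any using (here; there)
import Data.List.Relation.Unary.Any.Properties as Any
open import Data.List.Relation.Unary.Unique.Propositional using (Unique)
import Data.List.Relation.Unary.Unique.Propositional.Properties as Unique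
open import Data.Nat.Base as ℕ using (ℕ; zero; suc; NonZero; z≤n; s≤s; z<s; s<s; _!)
open import Data.Nat.Combinatorics using (_C_; nCn≡1; nCk≡nC[n∸k]; k![n∸k]!∣n!)
open import Data.Nat.Combinatorics.Specification using (nCk≡n!/k![n-k]!)
open import Data.Nat.Coprimality as Coprimality using (Coprime; coprime-divisor)
import Data.Nat.Divisibility as ℕ
import Data.Nat.DivMod as ℕ
open import Data.Nat.GCD using (gcd; gcd[m,n]∣m; gcd[m,n]∣n; gcd-GCD; module Bézout)
open import Data.Nat.Induction using (<-rec)
open import Data.Nat.Primality
  using (Prime; euclidsLemma; prime⇒nonTrivial; prime⇒nonZero; prime⇒irreducible)
open import Data.Nat.Primality.Factorisation using (factorise)
import Data.Nat.Properties as ℕ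
open import Data.List.Membership.DecPropositional ℕ._≟_ using (_∈?_)
open import Data.Nat.Tactic.RingSolver using () renaming (solve-∀ to solveℕ-∀)
open import Data.Product.Base using (∃; ∃₂; _×_; _,_; proj₁; proj₂)
open import Data.Rational.Base as ℚ using (ℚ)
import Data.Rational.Properties as ℚ
open import Data.Rational.Unnormalised.Base as ℚᵘ using (mkℚᵘ; *≤*; _≃_)
import Data.Rational.Unnormalised.Properties as ℚᵘ
open import Data.Sum.Base as Sum using (_⊎_; inj₁; inj₂; [_,_]′)
open import Function.Base using (_∘_; _$_)
open import Level using (0ℓ)
open import Relation.Binary.Bundles using (Setoid)
open import Relation.Binary.PropositionalEquality
import Relation.Binary.Reasoning.Setoid as SetoidReasoning
open import Relation.Nullary.Decidable.Core using (Dec; does; yes; no; map′)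
open import Relation.Nullary.Negation.Core using (¬_; contradiction)
open import Relation.Unary using (Pred; Decidable)

-- The coefficient 3/2 has two sources. The `p - 1` gaps have mean length `M/(p - 1) = p/g`.
-- Moreover, since a length occurs at most `g` times, `gk` gaps bounded by `L` fall short of `L` by
-- at least as much as the values 0, 1, ..., `k - 1` taken `g` times each, which is `(k - 1)/2` on
-- average. Hence `L ≥ p/g + (k - 1)/2 = (3p - 1 - g)/(2g)`. Working modulo `pk` instead of
-- `p(p - 1)` trades multiplicity for length: the circle shrinks by the factor `g`, while a
-- difference, now known only modulo `k` on the exponent side, may occur up to `g` times. Two points
-- need care. A gap that goes once around the whole circle is not a nonzero difference modulo `M`,
-- so the multiplicity bound says nothing about it. And a primitive root has to be built, as a
-- product of elements of prime power order that come from counting roots of `x^n - 1`.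

module Congruences where
  open import Data.Integer.Base using (∣_∣; _+_; _*_; _-_; -_; _^_)

  -- Congruences of integers, and roots of polynomials modulo a prime.

  infix 4 _≈_[mod_]

  -- The explicit quotient reduces the closure properties to ring identities. It also carries
  -- information used later: `labelled` reads a label off its residue modulo `g`.
  record _≈_[mod_] (a b : ℤ) (m : ℕ) : Set where
    constructor by
    field
      quotient : ℤ
      equation : a ≡ b + quotient * + m

  module _ {m : ℕ} where

    ≈-reflexive : ∀ {a b} → a ≡ b → a ≈ b [mod m ]
    ≈-reflexive {a} refl = by 0ℤ (sym (ℤ.+-identityʳ a))

    ≈-refl : ∀ {a} → a ≈ a [mod m ]
    ≈-refl = ≈-reflexive refl

    ≈-sym : ∀ {a b} → a ≈ b [mod m ] → b ≈ a [mod m ]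
    ≈-sym {b = b} (by q refl) = by (- q) (identity b q (+ m))
      where
      identity : ∀ b q m → b ≡ b + q * m + (- q) * m
      identity = solve-∀

    ≈-trans : ∀ {a b c} → a ≈ b [mod m ] → b ≈ c [mod m ] → a ≈ c [mod m ]
    ≈-trans {c = c} (by q refl) (by r refl) = by (q + r) (identity c q r (+ m))
      where
      identity : ∀ c q r m → c + r * m + q * m ≡ c + (q + r) * m
      identity = solve-∀

    +-cong : ∀ {a b c d} → a ≈ b [mod m ] → c ≈ d [mod m ] → a + c ≈ b + d [mod m ]
    +-cong {b = b} {d = d} (by q refl) (by r refl) = by (q + r) (identity b d q r (+ m))
      where
      identity : ∀ b d q r m → b + q * m + (d + r * m) ≡ b + d + (q + r) * m
      identity = solve-∀

    *-cong : ∀ {a b c d} → a ≈ b [mod m ] → c ≈ d [mod m ] → a * c ≈ b * d [mod m ]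
    *-cong {b = b} {d = d} (by q refl) (by r refl) =
      by (q * d + b * r + q * r * + m) (identity b d q r (+ m))
      where
      identity : ∀ b d q r m →
        (b + q * m) * (d + r * m) ≡ b * d + (q * d + b * r + q * r * m) * m
      identity = solve-∀

    ^-cong : ∀ {a b} n → a ≈ b [mod m ] → a ^ n ≈ b ^ n [mod m ]
    ^-cong zero    a≈b = ≈-refl
    ^-cong (suc n) a≈b = *-cong a≈b (^-cong n a≈b)

    *-multiple : ∀ q → q * + m ≈ 0ℤ [mod m ]
    *-multiple q = by q (sym (ℤ.+-identityˡ (q * + m)))

    ∣⇒≈0 : ∀ {a} → m ℕ.∣ ∣ a ∣ → a ≈ 0ℤ [mod m ]
    ∣⇒≈0 m∣a with divides q a≡qm ← ∣ᵤ⇒∣ {+ m} m∣a =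
      ≈-trans (≈-reflexive a≡qm) (*-multiple q)

    ≈0⇒∣ : ∀ {a} → a ≈ 0ℤ [mod m ] → m ℕ.∣ ∣ a ∣
    ≈0⇒∣ (by q a≡0+qm) = ∣⇒∣ᵤ (divides q (trans a≡0+qm (ℤ.+-identityˡ (q * + m))))

    ≈⇒-≈0 : ∀ {a b} → a ≈ b [mod m ] → a - b ≈ 0ℤ [mod m ]
    ≈⇒-≈0 {b = b} a≈b = ≈-trans (+-cong a≈b (≈-refl { - b })) (≈-reflexive (ℤ.+-inverseʳ b))

    -≈0⇒≈ : ∀ {a b} → a - b ≈ 0ℤ [mod m ] → a ≈ b [mod m ]
    -≈0⇒≈ {a} {b} a-b≈0 = ≈-trans (≈-reflexive (restore a b))
      (≈-trans (+-cong a-b≈0 (≈-refl {b})) (≈-reflexive (ℤ.+-identityˡ b)))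
      where
      restore : ∀ a b → a ≡ a - b + b
      restore = solve-∀

  ≈-setoid : ℕ → Setoid _ _
  ≈-setoid m = record
    { Carrier = ℤ
    ; _≈_ = _≈_[mod m ]
    ; isEquivalence = record { refl = ≈-refl ; sym = ≈-sym ; trans = ≈-trans } }

  ≈-mod? : ∀ m a b → Dec (a ≈ b [mod m ])
  ≈-mod? m a b = map′ (-≈0⇒≈ ∘ ∣⇒≈0) (≈0⇒∣ ∘ ≈⇒-≈0) (m ℕ.∣? ∣ a - b ∣)

  ≈-weaken : ∀ {m n a b} → n ℕ.∣ m → a ≈ b [mod m ] → a ≈ b [mod n ]
  ≈-weaken n∣m a≈b = -≈0⇒≈ (∣⇒≈0 (ℕ.∣-trans n∣m (≈0⇒∣ (≈⇒-≈0 a≈b))))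

  ^-distribʳ-* : ∀ n a b → (a * b) ^ n ≡ a ^ n * b ^ n
  ^-distribʳ-* zero    a b = refl
  ^-distribʳ-* (suc n) a b =
    trans (cong (a * b *_) (^-distribʳ-* n a b)) (interchange a b (a ^ n) (b ^ n))
    where
    interchange : ∀ a b c d → a * b * (c * d) ≡ a * c * (b * d)
    interchange = solve-∀

  module _ {p : ℕ} (p-prime : Prime p) where

    1≉0 : ¬ 1ℤ ≈ 0ℤ [mod p ]
    1≉0 1≈0 = ℕ.nonTrivial⇒≢1 {{prime⇒nonTrivial p-prime}} (ℕ.∣1⇒≡1 (≈0⇒∣ 1≈0))

    *≈0⇒≈0 : ∀ a b → a * b ≈ 0ℤ [mod p ] → a ≈ 0ℤ [mod p ] ⊎ b ≈ 0ℤ [mod p ]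
    *≈0⇒≈0 a b ab≈0 = Sum.map ∣⇒≈0 ∣⇒≈0 $
      euclidsLemma ∣ a ∣ ∣ b ∣ p-prime (subst (p ℕ.∣_) (ℤ.abs-* a b) (≈0⇒∣ ab≈0))

    *-cancelˡ-≈ : ∀ c {a b} → ¬ c ≈ 0ℤ [mod p ] → c * a ≈ c * b [mod p ] → a ≈ b [mod p ]
    *-cancelˡ-≈ c {a} {b} c≉0 ca≈cb =
      [ (λ c≈0 → contradiction c≈0 c≉0) , -≈0⇒≈ ]′ $
      *≈0⇒≈0 c (a - b) (≈-trans (≈-reflexive (distrib c a b)) (≈⇒-≈0 ca≈cb))
      where
      distrib : ∀ c a b → c * (a - b) ≡ c * a - c * b
      distrib = solve-∀

    ^≈1⇒≉0 : ∀ a n .{{_ : NonZero n}} → a ^ n ≈ 1ℤ [mod p ] → ¬ a ≈ 0ℤ [mod p ]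
    ^≈1⇒≉0 a (suc n) aⁿ≈1 a≈0 = 1≉0 (≈-trans (≈-sym aⁿ≈1) (*-cong a≈0 (≈-refl {a = a ^ n})))

    ^-≉0 : ∀ a n → ¬ a ≈ 0ℤ [mod p ] → ¬ a ^ n ≈ 0ℤ [mod p ]
    ^-≉0 a zero    a≉0 = 1≉0
    ^-≉0 a (suc n) a≉0 = [ a≉0 , ^-≉0 a n a≉0 ]′ ∘ *≈0⇒≈0 a (a ^ n)

  -- A list of coefficients c₀, …, cₙ₋₁ stands for the monic polynomial
  -- c₀ + c₁ x + … + cₙ₋₁ xⁿ⁻¹ + xⁿ.
  eval : List ℤ → ℤ → ℤ
  eval []       x = 1ℤ
  eval (c ∷ cs) x = c + x * eval cs x

  -- The quotient of c ∷ cs by x - a, which does not depend on c.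
  quotientBy : ℤ → List ℤ → List ℤ
  quotientBy a []       = []
  quotientBy a (c ∷ cs) = eval (c ∷ cs) a ∷ quotientBy a cs

  length-quotientBy : ∀ a cs → length (quotientBy a cs) ≡ length cs
  length-quotientBy a []       = refl
  length-quotientBy a (c ∷ cs) = cong suc (length-quotientBy a cs)

  -- Horner's scheme: the values at `a` of the tails of the coefficient list are the coefficients of
  -- the quotient, so induction along the list gives division with remainder.
  eval-quotientBy : ∀ a c cs x →
    eval (c ∷ cs) x ≡ eval (c ∷ cs) a + (x - a) * eval (quotientBy a cs) x
  eval-quotientBy a c [] x = linear a c x
    where
    linear : ∀ a c x → c + x * 1ℤ ≡ c + a * 1ℤ + (x - a) * 1ℤ
    linear = solve-∀
  eval-quotientBy a c (d ∷ ds) x =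
    trans (cong (λ z → c + x * z) (eval-quotientBy a d ds x))
          (step a c x (eval (d ∷ ds) a) (eval (quotientBy a ds) x))
    where
    step : ∀ a c x h q → c + x * (h + (x - a) * q) ≡ c + a * h + (x - a) * (h + x * q)
    step = solve-∀

  eval-replicate-0 : ∀ n x → eval (replicate n 0ℤ) x ≡ x ^ n
  eval-replicate-0 zero    x = refl
  eval-replicate-0 (suc n) x =
    trans (ℤ.+-identityˡ _) (cong (x *_) (eval-replicate-0 n x))

  module _ {p : ℕ} (p-prime : Prime p) where

    -- Dividing by `x - r` lowers the degree by one, and every other root stays a root of the
    -- quotient because it is incongruent to `r` and there are no zero divisors modulo `p`. Monic
    -- polynomials keep the induction going: the last quotient is the constant 1, which has no root.
    roots≤degree : ∀ cs rs → AllPairs (λ r s → ¬ r ≈ s [mod p ]) rs →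
      All (λ r → eval cs r ≈ 0ℤ [mod p ]) rs → length rs ℕ.≤ length cs
    roots≤degree _  [] _ _ = z≤n
    roots≤degree [] (_ ∷ _) _ (1≈0 ∷ _) = contradiction 1≈0 (1≉0 p-prime)
    roots≤degree (c ∷ cs) (r ∷ rs) (r≉rs ∷ distinct) (r-root ∷ rs-roots) =
      s≤s (subst (length rs ℕ.≤_) (length-quotientBy r cs)
        (roots≤degree (quotientBy r cs) rs distinct
          (All.map (λ {s} (r≉s , s-root) → root s r≉s s-root) (All.zip (r≉rs , rs-roots)))))
      where
      root : ∀ s → ¬ r ≈ s [mod p ] → eval (c ∷ cs) s ≈ 0ℤ [mod p ] →
        eval (quotientBy r cs) s ≈ 0ℤ [mod p ]
      root s r≉s s-root =
        [ (λ s-r≈0 → contradiction (≈-sym (-≈0⇒≈ s-r≈0)) r≉s) , (λ q≈0 → q≈0) ]′ $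
        *≈0⇒≈0 p-prime (s - r) _ (begin
          (s - r) * q                     ≈⟨ ≈-reflexive (ℤ.+-identityˡ _) ⟨
          0ℤ + (s - r) * q                ≈⟨ +-cong r-root ≈-refl ⟨
          eval (c ∷ cs) r + (s - r) * q   ≈⟨ ≈-reflexive (eval-quotientBy r c cs s) ⟨
          eval (c ∷ cs) s                 ≈⟨ s-root ⟩
          0ℤ                              ∎)
        where
        open SetoidReasoning (≈-setoid p)
        q = eval (quotientBy r cs) s

    unityRoots≤ : ∀ n .{{_ : NonZero n}} rs → AllPairs (λ r s → ¬ r ≈ s [mod p ]) rs →
      All (λ r → r ^ n ≈ 1ℤ [mod p ]) rs → length rs ℕ.≤ n
    unityRoots≤ (suc n) rs distinct roots =
      subst (λ l → length rs ℕ.≤ suc l) (List.length-replicate n)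
        -- This coefficient list encodes `x^(n + 1) - 1`; the leading 1 is implicit.
        (roots≤degree (-1ℤ ∷ replicate n 0ℤ) rs distinct (All.map (λ {r} → vanish r) roots))
      where
      vanish : ∀ r → r ^ suc n ≈ 1ℤ [mod p ] → eval (-1ℤ ∷ replicate n 0ℤ) r ≈ 0ℤ [mod p ]
      vanish r rⁿ≈1 = +-cong (≈-refl {a = -1ℤ})
        (≈-trans (≈-reflexive (cong (r *_) (eval-replicate-0 n r))) rⁿ≈1)

open Congruences

-- Fermat's little theorem through binomial coefficients.

module Fermat where
  open import Data.Integer.Base using (_+_; _*_; _^_)
  open import Algebra.Properties.Semiring.Sum ℤ.+-*-semiring using (sum; sum-init-last)
  open import Algebra.Definitions.RawSemiring ℤ.+-*-rawSemiring
    using () renaming (_×_ to _×ᵣ_; _^_ to _^ᵣ_)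
  import Algebra.Properties.CommutativeSemiring.Binomial ℤ.+-*-commutativeSemiring as Binomial

  n∣n! : ∀ n .{{_ : NonZero n}} → n ℕ.∣ n !
  n∣n! (suc n) = ℕ.m∣m*n (n !)

  module _ {p : ℕ} (p-prime : Prime p) where

    p∤k! : ∀ {k} → k ℕ.< p → p ℕ.∤ k !
    p∤k! {zero}  _   p∣1 = ℕ.nonTrivial⇒≢1 {{prime⇒nonTrivial p-prime}} (ℕ.∣1⇒≡1 p∣1)
    p∤k! {suc k} k<p p∣k! with euclidsLemma (suc k) (k !) p-prime p∣k!
    ... | inj₁ p∣1+k = ℕ.>⇒∤ k<p p∣1+k
    ... | inj₂ p∣k!  = p∤k! (ℕ.<-trans (ℕ.n<1+n k) k<p) p∣k!

    -- The prime `p` divides `p! = (p C k) · k! (p - k)!` but neither factorial on the right, since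
    -- `k` and `p - k` are both smaller than `p`.
    p∣pCk : ∀ {k} → 0 ℕ.< k → k ℕ.< p → p ℕ.∣ p C k
    p∣pCk {k} 0<k k<p = [ (λ p∣pCk → p∣pCk) , (λ p∣d → contradiction p∣d p∤d) ]′ $
      euclidsLemma (p C k) (k ! ℕ.* (p ℕ.∸ k) !) p-prime
        (subst (p ℕ.∣_) p!≡ (n∣n! p {{prime⇒nonZero p-prime}}))
      where
      instance
        _ = k ℕ.!* (p ℕ.∸ k) !≢0
      p!≡ : p ! ≡ (p C k) ℕ.* (k ! ℕ.* (p ℕ.∸ k) !)
      p!≡ = sym $ trans
        (cong (ℕ._* (k ! ℕ.* (p ℕ.∸ k) !)) (nCk≡n!/k![n-k]! (ℕ.<⇒≤ k<p)))
        (ℕ.m/n*n≡m (k![n∸k]!∣n! (ℕ.<⇒≤ k<p)))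
      p∤d : p ℕ.∤ k ! ℕ.* (p ℕ.∸ k) !
      p∤d = [ p∤k! k<p , p∤k! (ℕ.∸-monoʳ-< 0<k (ℕ.<⇒≤ k<p)) ]′ ∘ euclidsLemma (k !) _ p-prime

  ×≡* : ∀ n i → n ×ᵣ i ≡ + n * i
  ×≡* zero    i = refl
  ×≡* (suc n) i = trans (cong (λ j → i + j) (×≡* n i)) (sym (ℤ.suc-* (+ n) i))

  ×≈0 : ∀ {m n} → m ℕ.∣ n → ∀ i → n ×ᵣ i ≈ 0ℤ [mod m ]
  ×≈0 {n = n} m∣n i = ≈-trans (≈-reflexive (×≡* n i))
    (*-cong {a = + n} {c = i} {d = i} (∣⇒≈0 m∣n) ≈-refl)

  ^ᵣ≡^ : ∀ i n → i ^ᵣ n ≡ i ^ n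
  ^ᵣ≡^ i zero    = refl
  ^ᵣ≡^ i (suc n) = cong (i *_) (^ᵣ≡^ i n)

  sum≈0 : ∀ {m n} (t : Fin n → ℤ) → (∀ i → t i ≈ 0ℤ [mod m ]) → sum t ≈ 0ℤ [mod m ]
  sum≈0 {n = zero}  t t≈0 = ≈-refl
  sum≈0 {n = suc n} t t≈0 = +-cong (t≈0 zero) (sum≈0 (t ∘ suc) (t≈0 ∘ suc))

  nC0≡1 : ∀ n → n C 0 ≡ 1
  nC0≡1 n = trans (nCk≡nC[n∸k] {k = 0} {n = n} z≤n) (nCn≡1 n)

  -- Of the binomial expansion only the two end terms survive modulo `p`, so the sum is split at
  -- both ends. This is the induction step of `fermat`.
  freshman : ∀ {p} → Prime p → ∀ a → (1ℤ + a) ^ p ≈ 1ℤ + a ^ p [mod p ]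
  freshman {suc n} p-prime a = begin
    (1ℤ + a) ^ suc n                          ≈⟨ ≈-reflexive (sym (^ᵣ≡^ (1ℤ + a) (suc n))) ⟩
    (1ℤ + a) ^ᵣ suc n                         ≈⟨ ≈-reflexive (Binomial.theorem (suc n) 1ℤ a) ⟩
    sum t                                     ≈⟨ ≈-reflexive (cong (λ z → t zero + z) (sum-init-last (t ∘ suc))) ⟩
    t zero + (sum middle + t (fromℕ (suc n))) ≈⟨ +-cong first (+-cong (sum≈0 middle middle≈0) last) ⟩
    a ^ suc n + (0ℤ + 1ℤ)                     ≈⟨ ≈-reflexive (ℤ.+-comm (a ^ suc n) 1ℤ) ⟩
    1ℤ + a ^ suc n                            ∎
    where
    open SetoidReasoning (≈-setoid (suc n))
    t : Fin (suc (suc n)) → ℤ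
    t = Binomial.binomialTerm 1ℤ a (suc n)

    middle : Fin n → ℤ
    middle i = t (suc (inject₁ i))

    middle≈0 : ∀ i → middle i ≈ 0ℤ [mod suc n ]
    middle≈0 i = ×≈0 (p∣pCk p-prime z<s
      (s<s (subst (ℕ._< n) (sym (Fin.toℕ-inject₁ i)) (Fin.toℕ<n i)))) _

    first : t zero ≈ a ^ suc n [mod suc n ]
    first = ≈-reflexive (≡.begin
      (suc n C 0) ×ᵣ (1ℤ * a ^ᵣ suc n) ≡.≡⟨ ×≡* (suc n C 0) _ ⟩
      + (suc n C 0) * (1ℤ * a ^ᵣ suc n) ≡.≡⟨ cong₂ (λ c z → + c * z) (nC0≡1 (suc n)) (ℤ.*-identityˡ _) ⟩
      1ℤ * a ^ᵣ suc n ≡.≡⟨ ℤ.*-identityˡ _ ⟩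
      a ^ᵣ suc n ≡.≡⟨ ^ᵣ≡^ a (suc n) ⟩
      a ^ suc n ≡.∎)
      where module ≡ = ≡-Reasoning

    last : t (fromℕ (suc n)) ≈ 1ℤ [mod suc n ]
    last = ≈-reflexive (≡.begin
      (suc n C k) ×ᵣ (1ℤ ^ᵣ k * a ^ᵣ (suc n ℕ.∸ k)) ≡.≡⟨ ×≡* (suc n C k) _ ⟩
      + (suc n C k) * (1ℤ ^ᵣ k * a ^ᵣ (suc n ℕ.∸ k))
        ≡.≡⟨ cong (λ k → + (suc n C k) * (1ℤ ^ᵣ k * a ^ᵣ (suc n ℕ.∸ k))) (Fin.toℕ-fromℕ (suc n)) ⟩
      + (suc n C suc n) * (1ℤ ^ᵣ suc n * a ^ᵣ (n ℕ.∸ n))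
        ≡.≡⟨ cong₂ (λ c d → + c * (1ℤ ^ᵣ suc n * a ^ᵣ d)) (nCn≡1 (suc n)) (ℕ.n∸n≡0 n) ⟩
      1ℤ * (1ℤ ^ᵣ suc n * 1ℤ) ≡.≡⟨ trans (ℤ.*-identityˡ _) (ℤ.*-identityʳ _) ⟩
      1ℤ ^ᵣ suc n ≡.≡⟨ trans (^ᵣ≡^ 1ℤ (suc n)) (ℤ.^-zeroˡ (suc n)) ⟩
      1ℤ ≡.∎)
      where
      module ≡ = ≡-Reasoning
      k = toℕ (fromℕ (suc n))

  module _ {p : ℕ} (p-prime : Prime p) where

    fermat : ∀ a → (+ a) ^ p ≈ + a [mod p ]
    fermat zero    = ≈-reflexive (0^n≡0 p {{prime⇒nonZero p-prime}})
      where
      0^n≡0 : ∀ n .{{_ : NonZero n}} → 0ℤ ^ n ≡ 0ℤ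
      0^n≡0 (suc n) = refl
    fermat (suc a) = ≈-trans (freshman p-prime (+ a)) (+-cong (≈-refl {a = 1ℤ}) (fermat a))

    fermat-unit : ∀ {n} → p ≡ suc n → ∀ a → ¬ + a ≈ 0ℤ [mod p ] → (+ a) ^ n ≈ 1ℤ [mod p ]
    fermat-unit {n} p≡1+n a a≉0 = *-cancelˡ-≈ p-prime (+ a) a≉0 (begin
      + a * (+ a) ^ n    ≡⟨ cong ((+ a) ^_) p≡1+n ⟨
      (+ a) ^ p          ≈⟨ fermat a ⟩
      + a                ≡⟨ ℤ.*-identityʳ (+ a) ⟨
      + a * 1ℤ           ∎)
      where open SetoidReasoning (≈-setoid p)

open Fermat

-- Multiplicative orders and the existence of primitive roots.

module PrimitiveRoots where
  open import Data.Integer.Base using (∣_∣; _+_; _*_; _-_; _^_)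

  prime∤⇒coprime : ∀ {q n} → Prime q → q ℕ.∤ n → Coprime q n
  prime∤⇒coprime {n = n} q-prime q∤n (d∣q , d∣n) with prime⇒irreducible q-prime d∣q
  ... | inj₁ d≡1 = d≡1
  ... | inj₂ d≡q = contradiction (subst (ℕ._∣ n) d≡q d∣n) q∤n

  -- As `c` is coprime to `q`, the factors `q` of the power can be cancelled one at a time.
  ∣q^∧q∤⇒≡1 : ∀ {q c} → Prime q → ∀ n → q ℕ.∤ c → c ℕ.∣ q ℕ.^ n → c ≡ 1
  ∣q^∧q∤⇒≡1 q-prime zero    q∤c c∣1  = ℕ.∣1⇒≡1 c∣1
  ∣q^∧q∤⇒≡1 q-prime (suc n) q∤c c∣qⁿ =
    ∣q^∧q∤⇒≡1 q-prime n q∤c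
      (coprime-divisor (Coprimality.sym (prime∤⇒coprime q-prime q∤c)) c∣qⁿ)

  -- Everything depends on the cofactor `c` of `d`: if `q` divides it, one `q` cancels and `d`
  -- divides `q^e`; otherwise `c` is a divisor of a power of `q` prime to `q`, hence 1. The
  -- dichotomy lets the single exponent `q^e` decide whether an order is the full `q^(e + 1)`.
  ∣q^1+e : ∀ {q d} → Prime q → ∀ e → d ℕ.∣ q ℕ.^ suc e → d ℕ.∣ q ℕ.^ e ⊎ q ℕ.^ suc e ℕ.∣ d
  ∣q^1+e {q} {d} q-prime e (ℕ.divides c eq) with q ℕ.∣? c
  ... | no q∤c = inj₂ (ℕ.∣-reflexive (trans eq (trans
      (cong (ℕ._* d) (∣q^∧q∤⇒≡1 q-prime (suc e) q∤c (ℕ.divides d (trans eq (ℕ.*-comm c d)))))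
      (ℕ.*-identityˡ d))))
  ... | yes (ℕ.divides c′ refl) = inj₁ (ℕ.divides c′ (ℕ.*-cancelˡ-≡ _ _ q (trans eq (trans
      (cong (ℕ._* d) (ℕ.*-comm c′ q)) (ℕ.*-assoc q c′ d)))))
    where
    instance
      _ = prime⇒nonZero q-prime

  q∤⇒coprime-^ : ∀ {q m} → Prime q → ∀ e → q ℕ.∤ m → Coprime (q ℕ.^ e) m
  q∤⇒coprime-^ q-prime e q∤m (d∣qᵉ , d∣m) =
    ∣q^∧q∤⇒≡1 q-prime e (λ q∣d → q∤m (ℕ.∣-trans q∣d d∣m)) d∣qᵉ

  coprime-*-∣ : ∀ {m n j} → Coprime m n → m ℕ.∣ j → n ℕ.∣ j → m ℕ.* n ℕ.∣ j
  coprime-*-∣ {m} {n} m⊥n (ℕ.divides a refl) n∣am = subst (m ℕ.* n ℕ.∣_) (ℕ.*-comm m a)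
    (ℕ.*-monoʳ-∣ m (coprime-divisor (Coprimality.sym m⊥n) (subst (n ℕ.∣_) (ℕ.*-comm a m) n∣am)))

  primeDivisor : ∀ n .{{_ : NonZero n}} → n ≢ 1 → ∃ λ q → Prime q × q ℕ.∣ n
  primeDivisor n n≢1 with factorise n
  ... | record { factors = [] ; isFactorisation = n≡1 } = contradiction n≡1 n≢1
  ... | record { factors = q ∷ qs ; isFactorisation = refl ; factorsPrime = q-prime ∷ _ } =
    q , q-prime , ℕ.m∣m*n _

  removePrime : ∀ {q} → Prime q → ∀ n .{{_ : NonZero n}} →
    ∃₂ λ e m → n ≡ q ℕ.^ e ℕ.* m × q ℕ.∤ m
  removePrime {q} q-prime n = <-rec P step n
    where
    P : ℕ → Set
    P n = .{{_ : NonZero n}} → ∃₂ λ e m → n ≡ q ℕ.^ e ℕ.* m × q ℕ.∤ m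
    r<rq : ∀ r → .{{NonZero (r ℕ.* q)}} → r ℕ.< r ℕ.* q
    r<rq r = ℕ.m<m*n r q {{ℕ.m*n≢0⇒m≢0 r}} (ℕ.nonTrivial⇒n>1 q {{prime⇒nonTrivial q-prime}})
    step : ∀ n → (∀ {i} → i ℕ.< n → P i) → P n
    step n rec with q ℕ.∣? n
    ... | no q∤n = 0 , n , sym (ℕ.*-identityˡ n) , q∤n
    ... | yes (ℕ.divides r refl) with e , m , r≡ , q∤m ← rec {r} (r<rq r) {{ℕ.m*n≢0⇒m≢0 r}} =
      suc e , m , trans (ℕ.*-comm r q) (trans (cong (q ℕ.*_) r≡) (sym (ℕ.*-assoc q _ m))) , q∤m

  -- The exponent is written `suc e` because the order test for prime powers refers to `q^e`. Taking
  -- the full power of `q` makes the cofactor coprime to it, as `order-*` requires.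
  splitPrimePower : ∀ n .{{_ : NonZero n}} → n ≢ 1 →
    ∃ λ q → ∃₂ λ e m → Prime q × q ℕ.∤ m × n ≡ q ℕ.^ suc e ℕ.* m
  splitPrimePower n n≢1 with primeDivisor n n≢1
  ... | q , q-prime , q∣n with removePrime q-prime n
  ...   | zero  , m , n≡ , q∤m =
    contradiction (subst (q ℕ.∣_) (trans n≡ (ℕ.*-identityˡ m)) q∣n) q∤m
  ...   | suc e , m , n≡ , q∤m = q , e , m , q-prime , q∤m , n≡

  cofactor< : ∀ {q} → Prime q → ∀ e m .{{_ : NonZero (q ℕ.^ suc e ℕ.* m)}} → m ℕ.< q ℕ.^ suc e ℕ.* m
  cofactor< {q} q-prime e m = subst (m ℕ.<_) (ℕ.*-comm m (q ℕ.^ suc e))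
    (ℕ.m<m*n m (q ℕ.^ suc e) {{ℕ.m*n≢0⇒n≢0 (q ℕ.^ suc e)}}
      (ℕ.<-≤-trans (ℕ.nonTrivial⇒n>1 q {{prime⇒nonTrivial q-prime}})
        (ℕ.m≤m*n q (q ℕ.^ e) {{ℕ.m^n≢0 q e {{prime⇒nonZero q-prime}}}})))

  module _ {m : ℕ} where

    +-injective-mod : ∀ {a b} → a ℕ.< m → b ℕ.< m → + a ≈ + b [mod m ] → a ≡ b
    +-injective-mod {a} {b} a<m b<m a≈b =
      ℤ.+-injective (ℤ.i-j≡0⇒i≡j (+ a) (+ b) (ℤ.∣i∣≡0⇒i≡0 (small (≈0⇒∣ (≈⇒-≈0 a≈b)) bound)))
      where
      bound : ∣ + a - + b ∣ ℕ.< m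
      bound = subst (λ i → ∣ i ∣ ℕ.< m) (sym (ℤ.m-n≡m⊖n a b))
        (ℕ.≤-<-trans (ℤ.∣m⊝n∣≤m⊔n a b) (ℕ.⊔-lub a<m b<m))
      small : ∀ {k} → m ℕ.∣ k → k ℕ.< m → k ≡ 0
      small {zero}  _   _   = refl
      small {suc k} m∣k k<m = contradiction m∣k (ℕ.>⇒∤ k<m)

    ^-∣ : ∀ x j {k} → x ^ j ≈ 1ℤ [mod m ] → j ℕ.∣ k → x ^ k ≈ 1ℤ [mod m ]
    ^-∣ x j xʲ≈1 (ℕ.divides q refl) = begin
      x ^ (q ℕ.* j)  ≡⟨ cong (x ^_) (ℕ.*-comm q j) ⟩
      x ^ (j ℕ.* q)  ≡⟨ ℤ.^-*-assoc x j q ⟨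
      (x ^ j) ^ q    ≈⟨ ^-cong q xʲ≈1 ⟩
      1ℤ ^ q         ≡⟨ ℤ.^-zeroˡ q ⟩
      1ℤ             ∎
      where open SetoidReasoning (≈-setoid m)

    -- Over the naturals the Bézout identity reads `d + a = b` with `a` and `b` multiples of the two
    -- exponents, so `x^d · x^a = x^b` settles the claim without negative powers.
    ^-gcd : ∀ x j k → x ^ j ≈ 1ℤ [mod m ] → x ^ k ≈ 1ℤ [mod m ] → x ^ gcd j k ≈ 1ℤ [mod m ]
    ^-gcd x j k xʲ≈1 xᵏ≈1 = from-identity (Bézout.identity (gcd-GCD j k))
      where
      open SetoidReasoning (≈-setoid m)
      step : ∀ d a b → d ℕ.+ a ≡ b → x ^ a ≈ 1ℤ [mod m ] → x ^ b ≈ 1ℤ [mod m ] → x ^ d ≈ 1ℤ [mod m ]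
      step d a b d+a≡b xᵃ≈1 xᵇ≈1 = begin
        x ^ d          ≡⟨ ℤ.*-identityʳ (x ^ d) ⟨
        x ^ d * 1ℤ     ≈⟨ *-cong (≈-refl {a = x ^ d}) xᵃ≈1 ⟨
        x ^ d * x ^ a  ≡⟨ ℤ.^-distribˡ-+-* x d a ⟨
        x ^ (d ℕ.+ a)  ≡⟨ cong (x ^_) d+a≡b ⟩
        x ^ b          ≈⟨ xᵇ≈1 ⟩
        1ℤ             ∎
      from-identity : Bézout.Identity (gcd j k) j k → x ^ gcd j k ≈ 1ℤ [mod m ]
      from-identity (Bézout.+- u v eq) = step _ (v ℕ.* k) (u ℕ.* j) eq
        (^-∣ x k xᵏ≈1 (ℕ.n∣m*n v)) (^-∣ x j xʲ≈1 (ℕ.n∣m*n u))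
      from-identity (Bézout.-+ u v eq) = step _ (u ℕ.* j) (v ℕ.* k) eq
        (^-∣ x j xʲ≈1 (ℕ.n∣m*n u)) (^-∣ x k xᵏ≈1 (ℕ.n∣m*n v))

  -- Divisibility replaces minimality because it is the form in which coprime orders combine.
  record HasOrder (p : ℕ) (x : ℤ) (n : ℕ) : Set where
    field
      ^≈1   : x ^ n ≈ 1ℤ [mod p ]
      order : ∀ j → x ^ j ≈ 1ℤ [mod p ] → n ℕ.∣ j

  open HasOrder

  -- If `(xy)^j` is 1, its `n`-th power is `x^(nj)`, because `y^n` is 1. So `m` divides `nj` and, by
  -- coprimality, `j`; the same holds for `n` with the roles exchanged.
  order-* : ∀ {p x y m n} → Coprime m n → HasOrder p x m → HasOrder p y n → HasOrder p (x * y) (m ℕ.* n)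
  order-* {p} {x} {y} {m} {n} m⊥n ox oy = record
    { ^≈1 = ≈-trans (≈-reflexive (^-distribʳ-* (m ℕ.* n) x y))
        (*-cong (^-∣ x m (^≈1 ox) (ℕ.m∣m*n n)) (^-∣ y n (^≈1 oy) (ℕ.n∣m*n m)))
    ; order = λ j xyʲ≈1 → coprime-*-∣ m⊥n
        (component m⊥n ox oy j xyʲ≈1)
        (component (Coprimality.sym m⊥n) oy ox j
          (≈-trans (≈-reflexive (cong (_^ j) (ℤ.*-comm y x))) xyʲ≈1)) }
    where
    open SetoidReasoning (≈-setoid p)
    component : ∀ {x y m n} → Coprime m n → HasOrder p x m → HasOrder p y n →
      ∀ j → (x * y) ^ j ≈ 1ℤ [mod p ] → m ℕ.∣ j
    component {x} {y} {m} {n} m⊥n ox oy j xyʲ≈1 = coprime-divisor m⊥n (order ox (n ℕ.* j) (begin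
      x ^ (n ℕ.* j)                  ≡⟨ ℤ.*-identityʳ (x ^ (n ℕ.* j)) ⟨
      x ^ (n ℕ.* j) * 1ℤ             ≈⟨ *-cong (≈-refl {a = x ^ (n ℕ.* j)}) (^-∣ y n (^≈1 oy) (ℕ.m∣m*n j)) ⟨
      x ^ (n ℕ.* j) * y ^ (n ℕ.* j)  ≡⟨ ^-distribʳ-* (n ℕ.* j) x y ⟨
      (x * y) ^ (n ℕ.* j)            ≈⟨ ^-∣ (x * y) j xyʲ≈1 (ℕ.n∣m*n n) ⟩
      1ℤ                             ∎))

  -- If `y^j` is 1, so is `y` to the power `gcd j (q^(e + 1))`. Were this gcd a proper divisor of
  -- `q^(e + 1)`, it would divide `q^e` and force `y^(q^e)` to be 1.
  order-prime-power : ∀ {p q y} → Prime q → ∀ e → y ^ (q ℕ.^ suc e) ≈ 1ℤ [mod p ] →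
    ¬ y ^ (q ℕ.^ e) ≈ 1ℤ [mod p ] → HasOrder p y (q ℕ.^ suc e)
  order-prime-power {p} {q} {y} q-prime e y≈1 y≉1 = record { ^≈1 = y≈1 ; order = multiple }
    where
    multiple : ∀ j → y ^ j ≈ 1ℤ [mod p ] → q ℕ.^ suc e ℕ.∣ j
    multiple j yʲ≈1 with ∣q^1+e q-prime e (gcd[m,n]∣n j (q ℕ.^ suc e))
    ... | inj₁ d∣qᵉ = contradiction
      (^-∣ y (gcd j (q ℕ.^ suc e)) (^-gcd y j (q ℕ.^ suc e) yʲ≈1 y≈1) d∣qᵉ) y≉1
    ... | inj₂ qᵉ∣d = ℕ.∣-trans qᵉ∣d (gcd[m,n]∣m j (q ℕ.^ suc e))

  module _ {N : ℕ} .{{_ : NonZero N}} (p-prime : Prime (suc N)) where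

    private
      units : List ℤ
      units = applyUpTo (λ i → + suc i) N

      units-distinct : AllPairs (λ r s → ¬ r ≈ s [mod suc N ]) units
      units-distinct = AllPairs.applyUpTo⁺₁ _ N λ i<j j<N i≈j → ℕ.<⇒≢ (s<s i<j)
        (+-injective-mod (s<s (ℕ.<-trans i<j j<N)) (s<s j<N) i≈j)

    -- At most `n` of the `N` units are roots of `x^n - 1`. Congruence is decidable, so a search
    -- through the units turns this count into a witness.
    non-root : ∀ n .{{_ : NonZero n}} → n ℕ.< N →
      ∃ λ a → ¬ + a ≈ 0ℤ [mod suc N ] × ¬ (+ a) ^ n ≈ 1ℤ [mod suc N ]
    non-root n n<N with All.all? (λ r → ≈-mod? (suc N) (r ^ n) 1ℤ) units
    ... | yes roots = contradiction n<N (ℕ.≤⇒≯ (subst (ℕ._≤ n) (List.length-applyUpTo _ N)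
      (unityRoots≤ p-prime n units units-distinct roots)))
    ... | no ¬roots
      with i , i<N , aⁿ≉1 ← Any.applyUpTo⁻ _
             (All.¬All⇒Any¬ (λ r → ≈-mod? (suc N) (r ^ n) 1ℤ) units ¬roots) =
      suc i , (λ a≈0 → ℕ.>⇒∤ (s<s i<N) (≈0⇒∣ a≈0)) , aⁿ≉1

    -- With `c = N/q^(e + 1)` the product `c q^e` is `N/q`. Take a unit `a` with `a^(N/q)` not 1 and
    -- put `y = a^c`: then `y^(q^(e + 1)) = a^N` is 1 by Fermat, while `y^(q^e) = a^(N/q)` is not.
    element-of-prime-power-order : ∀ {q} → Prime q → ∀ e → q ℕ.^ suc e ℕ.∣ N →
      ∃ λ y → HasOrder (suc N) y (q ℕ.^ suc e)
    element-of-prime-power-order {q} q-prime e (ℕ.divides c N≡) = power (non-root (c ℕ.* q ℕ.^ e) cqᵉ<N)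
      where
      instance
        q≢0 = prime⇒nonZero q-prime
        c≢0 : NonZero c
        c≢0 = ℕ.m*n≢0⇒m≢0 c {{subst NonZero N≡ (ℕ.≢-nonZero (ℕ.≢-nonZero⁻¹ N))}}
        qᵉ≢0 = ℕ.m^n≢0 q e
        cqᵉ≢0 : NonZero (c ℕ.* q ℕ.^ e)
        cqᵉ≢0 = ℕ.m*n≢0 c (q ℕ.^ e)
      cqᵉ<N : c ℕ.* q ℕ.^ e ℕ.< N
      cqᵉ<N = subst (c ℕ.* q ℕ.^ e ℕ.<_) (sym N≡) (ℕ.*-monoʳ-< c
        (ℕ.^-monoʳ-< q (ℕ.nonTrivial⇒n>1 q {{prime⇒nonTrivial q-prime}}) (ℕ.n<1+n e)))
      power : (∃ λ a → ¬ + a ≈ 0ℤ [mod suc N ] × ¬ (+ a) ^ (c ℕ.* q ℕ.^ e) ≈ 1ℤ [mod suc N ]) →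
        ∃ λ y → HasOrder (suc N) y (q ℕ.^ suc e)
      power (a , a≉0 , a≉1) = (+ a) ^ c , order-prime-power q-prime e
        (≈-trans (≈-reflexive (trans (ℤ.^-*-assoc (+ a) c _) (cong ((+ a) ^_) (sym N≡))))
          (fermat-unit p-prime refl a a≉0))
        (λ y≈1 → a≉1 (≈-trans (≈-reflexive (sym (ℤ.^-*-assoc (+ a) c _))) y≈1))

    -- For `n = N` this yields a primitive root. General divisors carry the induction, which splits
    -- off one full prime power at a time.
    element-of-order : ∀ n → n ℕ.∣ N → ∃ λ x → HasOrder (suc N) x n
    element-of-order = <-rec P step
      where
      P : ℕ → Set
      P n = n ℕ.∣ N → ∃ λ x → HasOrder (suc N) x n
      divisor≢0 : ∀ {n} → n ℕ.∣ N → NonZero n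
      divisor≢0 n∣N = ℕ.≢-nonZero λ { refl → ℕ.≢-nonZero⁻¹ N (ℕ.0∣⇒≡0 n∣N) }
      step : ∀ n → (∀ {i} → i ℕ.< n → P i) → P n
      step n rec n∣N with n ℕ.≟ 1
      ... | yes refl = 1ℤ , record { ^≈1 = ≈-refl ; order = λ j _ → ℕ.1∣ j }
      ... | no n≢1 with splitPrimePower n {{divisor≢0 n∣N}} n≢1
      ...   | q , e , m , q-prime , q∤m , refl =
        combine (element-of-prime-power-order q-prime e (ℕ.∣-trans (ℕ.m∣m*n m) n∣N))
                (rec (cofactor< q-prime e m {{divisor≢0 n∣N}}) (ℕ.∣-trans (ℕ.n∣m*n (q ℕ.^ suc e)) n∣N))
        where
        combine : (∃ λ y → HasOrder (suc N) y (q ℕ.^ suc e)) → (∃ λ x → HasOrder (suc N) x m) →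
          ∃ λ z → HasOrder (suc N) z (q ℕ.^ suc e ℕ.* m)
        combine (y , oy) (x , ox) = y * x , order-* (q∤⇒coprime-^ q-prime (suc e) q∤m) oy ox

open PrimitiveRoots

-- Gaps between cyclically consecutive residues of a modular Golomb ruler.

module ModularGaps where
  open import Data.Nat.Base using (_+_; _*_; _∸_; _≤_; _<_; _%_; pred)
  open import Data.Nat.ListAction using (sum)

  lookup-injective : {A : Set} {xs : List A} → Unique xs → ∀ i j → lookup xs i ≡ lookup xs j → i ≡ j
  lookup-injective (_ ∷ _)        zero    zero    _  = refl
  lookup-injective (x∉xs ∷ _)     zero    (suc j) eq = contradiction eq (All.lookup x∉xs (∈-lookup j))
  lookup-injective (x∉xs ∷ _)     (suc i) zero    eq = contradiction (sym eq) (All.lookup x∉xs (∈-lookup i))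
  lookup-injective (_ ∷ unique)   (suc i) (suc j) eq = cong suc (lookup-injective unique i j eq)

  -- The pigeonhole principle, with labels given by a relation because in the main application a
  -- label comes bundled with the exponents that witness it.
  length≤-by-labels : {A : Set} {xs : List A} {n : ℕ} (R : A → Fin n → Set) → Unique xs →
    (∀ {x} → x ∈ xs → ∃ (R x)) → (∀ {x y i} → R x i → R y i → x ≡ y) → length xs ≤ n
  length≤-by-labels {xs = xs} R unique total injective = Fin.injective⇒≤ {f = label} λ {i} {j} eq →
    lookup-injective unique i j (injective (labelled i) (subst (R (lookup xs j)) (sym eq) (labelled j)))
    where
    label : Fin (length xs) → _
    label i = proj₁ (total (∈-lookup i))
    labelled : ∀ i → R (lookup xs i) (label i)
    labelled i = proj₂ (total (∈-lookup i))

  length≤-⊆ : {A : Set} {xs ys : List A} → Unique xs → (∀ {x} → x ∈ xs → x ∈ ys) → length xs ≤ length ys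
  length≤-⊆ {ys = ys} unique xs⊆ys = length≤-by-labels (λ x i → x ≡ lookup ys i) unique
    (λ x∈xs → Any.index (xs⊆ys x∈xs) , Any.lookup-index (xs⊆ys x∈xs))
    (λ x≡ y≡ → trans x≡ (sym y≡))

  unique-map : {A B : Set} (f : A → B) {xs : List A} →
    (∀ {x y} → x ∈ xs → y ∈ xs → f x ≡ f y → x ≡ y) → Unique xs → Unique (map f xs)
  unique-map f injective [] = []
  unique-map f injective (x∉xs ∷ unique) =
    All.map⁺ (All.tabulate λ y∈xs fx≡fy →
      All.lookup x∉xs y∈xs (injective (here refl) (there y∈xs) fx≡fy)) ∷
    unique-map f (λ x∈xs y∈xs → injective (there x∈xs) (there y∈xs)) unique

  count : ℕ → List ℕ → ℕ
  count v = length ∘ filter (v ℕ.≟_)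

  count-map : {A : Set} (f : A → ℕ) → ∀ v xs → count v (map f xs) ≡ length (filter (λ x → v ℕ.≟ f x) xs)
  count-map f v [] = refl
  count-map f v (x ∷ xs) with does (v ℕ.≟ f x)
  ... | true  = cong suc (count-map f v xs)
  ... | false = count-map f v xs

  -- 0 + 1 + … + (k - 1)
  triangular : ℕ → ℕ
  triangular zero    = 0
  triangular (suc k) = k + triangular k

  triangular-double : ∀ k → 2 * triangular k + k ≡ k * k
  triangular-double zero    = refl
  triangular-double (suc k) = begin
    2 * (k + triangular k) + suc k            ≡⟨ regroup k (triangular k) ⟩
    (2 * triangular k + k) + (2 * k + 1)      ≡⟨ cong (_+ (2 * k + 1)) (triangular-double k) ⟩
    k * k + (2 * k + 1)                       ≡⟨ square k ⟩
    suc k * suc k                             ∎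
    where
    open ≡-Reasoning
    regroup : ∀ k t → 2 * (k + t) + suc k ≡ (2 * t + k) + (2 * k + 1)
    regroup = solveℕ-∀
    square : ∀ k → k * k + (2 * k + 1) ≡ suc k * suc k
    square = solveℕ-∀

  dropZeros : List ℕ → List ℕ
  dropZeros []           = []
  dropZeros (zero  ∷ us) = dropZeros us
  dropZeros (suc u ∷ us) = u ∷ dropZeros us

  count-dropZeros : ∀ v us → count v (dropZeros us) ≡ count (suc v) us
  count-dropZeros v [] = refl
  count-dropZeros v (zero  ∷ us) = count-dropZeros v us
  count-dropZeros v (suc u ∷ us) with does (v ℕ.≟ u)
  ... | true  = cong suc (count-dropZeros v us)
  ... | false = count-dropZeros v us

  length-dropZeros : ∀ us → length us ≡ count 0 us + length (dropZeros us)
  length-dropZeros []           = refl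
  length-dropZeros (zero  ∷ us) = cong suc (length-dropZeros us)
  length-dropZeros (suc u ∷ us) = trans (cong suc (length-dropZeros us)) (sym (ℕ.+-suc _ _))

  sum-dropZeros : ∀ us → sum us ≡ length (dropZeros us) + sum (dropZeros us)
  sum-dropZeros []           = refl
  sum-dropZeros (zero  ∷ us) = sum-dropZeros us
  sum-dropZeros (suc u ∷ us) = cong suc (trans (cong (u ℕ.+_) (sum-dropZeros us))
    (swap u (length (dropZeros us)) (sum (dropZeros us))))
    where
    swap : ∀ u l s → u + (l + s) ≡ l + (u + s)
    swap = solveℕ-∀

  -- Dropping the zeros, of which there are at most g, and lowering the rest by one
  -- turns the statement for k + 1 into the statement for k.
  g*triangular≤sum : ∀ g k us → (∀ v → count v us ≤ g) → g * k ≤ length us → g * triangular k ≤ sum us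
  g*triangular≤sum g zero    us _      _     = subst (_≤ sum us) (sym (ℕ.*-zeroʳ g)) z≤n
  g*triangular≤sum g (suc k) us count≤ long = begin
    g * (k + triangular k)                         ≡⟨ ℕ.*-distribˡ-+ g k (triangular k) ⟩
    g * k + g * triangular k                       ≤⟨ ℕ.+-mono-≤ long′
        (g*triangular≤sum g k (dropZeros us)
          (λ v → subst (_≤ g) (sym (count-dropZeros v us)) (count≤ (suc v))) long′) ⟩
    length (dropZeros us) + sum (dropZeros us)     ≡⟨ sum-dropZeros us ⟨
    sum us                                         ∎
    where
    open ℕ.≤-Reasoning
    long′ : g * k ≤ length (dropZeros us)
    long′ = ℕ.+-cancelˡ-≤ g (g * k) (length (dropZeros us)) $ begin
      g + g * k                           ≡⟨ ℕ.*-suc g k ⟨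
      g * suc k                           ≤⟨ long ⟩
      length us                           ≡⟨ length-dropZeros us ⟩
      count 0 us + length (dropZeros us)  ≤⟨ ℕ.+-monoˡ-≤ _ (count≤ 0) ⟩
      g + length (dropZeros us)           ∎

  -- Returns n if no t < n satisfies P.
  firstBelow : {P : Pred ℕ 0ℓ} → Decidable P → ℕ → ℕ
  firstBelow P? zero    = zero
  firstBelow P? (suc n) with P? zero
  ... | yes _ = zero
  ... | no  _ = suc (firstBelow (P? ∘ suc) n)

  firstBelow≤ : {P : Pred ℕ 0ℓ} (P? : Decidable P) → ∀ n → firstBelow P? n ≤ n
  firstBelow≤ P? zero    = z≤n
  firstBelow≤ P? (suc n) with P? zero
  ... | yes _ = z≤n
  ... | no  _ = s≤s (firstBelow≤ (P? ∘ suc) n)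

  firstBelow-holds : {P : Pred ℕ 0ℓ} (P? : Decidable P) → ∀ n → P n → P (firstBelow P? n)
  firstBelow-holds P? zero    p = p
  firstBelow-holds P? (suc n) p with P? zero
  ... | yes p₀ = p₀
  ... | no  _  = firstBelow-holds (P? ∘ suc) n p

  firstBelow-least : {P : Pred ℕ 0ℓ} (P? : Decidable P) → ∀ n {u} → u < firstBelow P? n → ¬ P u
  firstBelow-least P? (suc n) {u} u< with P? zero
  firstBelow-least P? (suc n) {zero}  u<       | no ¬p = ¬p
  firstBelow-least P? (suc n) {suc u} (s<s u<) | no ¬p = firstBelow-least (P? ∘ suc) n u<

  %-suc : ∀ {M} .{{_ : NonZero M}} a b → a % M ≡ b % M → suc a % M ≡ suc b % M
  %-suc {M} a b eq = begin
    suc a % M              ≡⟨ ℕ.%-distribˡ-+ 1 a M ⟩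
    (1 % M + a % M) % M    ≡⟨ cong (λ r → (1 % M + r) % M) eq ⟩
    (1 % M + b % M) % M    ≡⟨ ℕ.%-distribˡ-+ 1 b M ⟨
    suc b % M              ∎
    where open ≡-Reasoning

  -- Pairs with difference `t` are counted by their first entry, which determines the second.
  -- Quantifying over duplicate-free lists makes `few` applicable both to the starting points of
  -- gaps of one length and to the pairs of the integer ruler.
  record IsModularGolomb (g M : ℕ) .{{_ : NonZero M}} (A : List ℕ) : Set where
    field
      distinct : Unique A
      below    : ∀ {r} → r ∈ A → r < M
      few      : ∀ {t} → 0 < t → t < M → ∀ rs → Unique rs →
                 (∀ {r} → r ∈ rs → r ∈ A × (r + t) % M ∈ A) → length rs ≤ g

  module Gaps (M : ℕ) .{{_ : NonZero M}} (A : List ℕ) (below : ∀ {r} → r ∈ A → r < M) where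

    private
      marked? : ∀ r → Decidable (λ t → (r + suc t) % M ∈ A)
      marked? r t = (r + suc t) % M ∈? A

    -- For r ∉ A this may be the junk value M.
    gap : ℕ → ℕ
    gap r = suc (firstBelow (marked? r) (pred M))

    gap≤M : ∀ r → gap r ≤ M
    gap≤M r = subst (gap r ≤_) (ℕ.suc-pred M) (s≤s (firstBelow≤ (marked? r) (pred M)))

    -- This includes the case where the search finds nothing and `gap r` is `M`: going once around
    -- leads back to `r`, itself a mark.
    gap-∈ : ∀ {r} → r ∈ A → (r + gap r) % M ∈ A
    gap-∈ {r} r∈A = firstBelow-holds (marked? r) (pred M) (subst (_∈ A) (sym (begin
      (r + suc (pred M)) % M  ≡⟨ cong (λ m → (r + m) % M) (ℕ.suc-pred M) ⟩
      (r + M) % M             ≡⟨ ℕ.[m+n]%n≡m%n r M ⟩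
      r % M                   ≡⟨ ℕ.m<n⇒m%n≡m (below r∈A) ⟩
      r                       ∎)) r∈A)
      where open ≡-Reasoning

    gap-∉ : ∀ r {u} → 0 < u → u < gap r → (r + u) % M ∉ A
    gap-∉ r {suc u} _ (s<s u<) = firstBelow-least (marked? r) (pred M) u<

    -- The arcs are in fact disjoint, but covering suffices for M ≤ sum of the gaps.
    arcs : List ℕ → List ℕ
    arcs = concatMap λ r → map (λ t → (r + t) % M) (upTo (gap r))

    length-arcs : ∀ rs → length (arcs rs) ≡ sum (map gap rs)
    length-arcs []       = refl
    length-arcs (r ∷ rs) = trans (List.length-++ (map (λ t → (r + t) % M) (upTo (gap r))))
      (cong₂ _+_ (trans (List.length-map _ (upTo (gap r))) (List.length-upTo (gap r))) (length-arcs rs))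

    module _ {r₀} (r₀∈A : r₀ ∈ A) where

      -- A walk around the circle from `r₀` that remembers the last mark passed and the distance
      -- from it. When the distance would reach the gap, the next mark takes over at distance 0.
      previous : ∀ n → ∃₂ λ r t → r ∈ A × t < gap r × (r₀ + n) % M ≡ (r + t) % M
      previous zero    = r₀ , 0 , r₀∈A , z<s , refl
      previous (suc n) = next (previous n)
        where
        next : (∃₂ λ r t → r ∈ A × t < gap r × (r₀ + n) % M ≡ (r + t) % M) →
          ∃₂ λ r t → r ∈ A × t < gap r × (r₀ + suc n) % M ≡ (r + t) % M
        next (r , t , r∈A , t<gap , eq) = decide (ℕ.m≤n⇒m<n∨m≡n t<gap)
          where
          eq′ : (r₀ + suc n) % M ≡ (r + suc t) % M
          eq′ = subst₂ (λ a b → a % M ≡ b % M) (sym (ℕ.+-suc r₀ n)) (sym (ℕ.+-suc r t))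
            (%-suc (r₀ + n) (r + t) eq)
          decide : suc t < gap r ⊎ suc t ≡ gap r →
            ∃₂ λ r t → r ∈ A × t < gap r × (r₀ + suc n) % M ≡ (r + t) % M
          decide (inj₁ 1+t<gap) = r , suc t , r∈A , 1+t<gap , eq′
          decide (inj₂ 1+t≡gap) = (r + gap r) % M , 0 , gap-∈ r∈A , z<s , (begin
            (r₀ + suc n) % M             ≡⟨ eq′ ⟩
            (r + suc t) % M              ≡⟨ cong (λ s → (r + s) % M) 1+t≡gap ⟩
            (r + gap r) % M              ≡⟨ ℕ.m%n%n≡m%n (r + gap r) M ⟨
            (r + gap r) % M % M          ≡⟨ cong (_% M) (ℕ.+-identityʳ _) ⟨
            ((r + gap r) % M + 0) % M    ∎)
            where open ≡-Reasoning

      arcs-cover : ∀ {z} → z < M → z ∈ arcs A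
      -- Starting from `r₀`, the walk stands at `z` after `M ∸ r₀ + z` steps, since
      -- `r₀ + (M ∸ r₀) + z = M + z`.
      arcs-cover {z} z<M = locate (previous (M ∸ r₀ + z))
        where
        locate : (∃₂ λ r t → r ∈ A × t < gap r × (r₀ + (M ∸ r₀ + z)) % M ≡ (r + t) % M) → z ∈ arcs A
        locate (r , t , r∈A , t<gap , eq) = ∈-concatMap⁺ _ (Any.map (λ { refl →
          subst (_∈ map (λ t → (r + t) % M) (upTo (gap r))) (sym z≡) (∈-map⁺ _ (∈-upTo⁺ t<gap)) }) r∈A)
          where
          open ≡-Reasoning
          z≡ : z ≡ (r + t) % M
          z≡ = begin
            z                          ≡⟨ ℕ.m<n⇒m%n≡m z<M ⟨
            z % M                      ≡⟨ ℕ.[m+n]%n≡m%n z M ⟨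
            (z + M) % M                ≡⟨ cong (_% M) (ℕ.+-comm z M) ⟩
            (M + z) % M                ≡⟨ cong (λ m → (m + z) % M) (ℕ.m+[n∸m]≡n (ℕ.<⇒≤ (below r₀∈A))) ⟨
            (r₀ + (M ∸ r₀) + z) % M    ≡⟨ cong (_% M) (ℕ.+-assoc r₀ (M ∸ r₀) z) ⟩
            (r₀ + (M ∸ r₀ + z)) % M    ≡⟨ eq ⟩
            (r + t) % M                ∎

      M≤sum-gaps : M ≤ sum (map gap A)
      M≤sum-gaps = subst₂ _≤_ (List.length-upTo M) (length-arcs A)
        (length≤-⊆ (Unique.upTo⁺ M) (arcs-cover ∘ ∈-upTo⁻))

      widest : ∃ λ r → r ∈ A × (∀ {s} → s ∈ A → gap s ≤ gap r)
      widest = argmax gap r₀ A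
        , [ (λ eq → subst (_∈ A) (sym eq) r₀∈A) , (λ ∈A → ∈A) ]′ (argmax-sel gap r₀ A)
        , All.lookup (f[xs]≤f[argmax] r₀ A)

  sum-map-∸ : ∀ {A : Set} (f : A → ℕ) {L} xs → (∀ {x} → x ∈ xs → f x ≤ L) →
    sum (map (λ x → L ∸ f x) xs) + sum (map f xs) ≡ length xs * L
  sum-map-∸ f []       f≤L = refl
  sum-map-∸ f {L} (x ∷ xs) f≤L = trans
    (interchange (L ∸ f x) (sum (map (λ x → L ∸ f x) xs)) (f x) (sum (map f xs)))
    (cong₂ _+_ (ℕ.m∸n+n≡m (f≤L (here refl))) (sum-map-∸ f xs (f≤L ∘ there)))
    where
    interchange : ∀ a b c d → a + b + (c + d) ≡ a + c + (b + d)
    interchange = solveℕ-∀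

  module _ {g k M : ℕ} .{{_ : NonZero M}} {A : List ℕ} (golomb : IsModularGolomb g M A)
           (size : length A ≡ g * k) {r₀} (r₀∈A : r₀ ∈ A) where
    open IsModularGolomb golomb
    open Gaps M A below

    -- Together the gaps and their defects `L ∸ gap r` sum to `gkL`. Equal defects mean equal gaps,
    -- so each defect occurs at most `g` times and the `gk` defects sum to at least
    -- `g(0 + 1 + … + (k - 1))`. The assumption `L < M` keeps every gap a genuine nonzero difference
    -- modulo `M`.
    gap-sum-bound : ∀ {L} → L < M → (∀ {s} → s ∈ A → gap s ≤ L) → g * triangular k + M ≤ g * k * L
    gap-sum-bound {L} L<M gap≤L = begin
      g * triangular k + M                    ≤⟨ ℕ.+-mono-≤ (g*triangular≤sum g k (map defect A) few-defects
          (ℕ.≤-reflexive (sym (trans (List.length-map defect A) size)))) (M≤sum-gaps r₀∈A) ⟩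
      sum (map defect A) + sum (map gap A)    ≡⟨ sum-map-∸ gap A gap≤L ⟩
      length A * L                            ≡⟨ cong (_* L) size ⟩
      g * k * L                               ∎
      where
      open ℕ.≤-Reasoning
      defect : ℕ → ℕ
      defect r = L ∸ gap r
      few-defects : ∀ v → count v (map defect A) ≤ g
      few-defects v = subst (_≤ g) (sym (count-map defect v A)) (bound (filter P? A) refl)
        where
        P? : Decidable (λ r → v ≡ defect r)
        P? r = v ℕ.≟ defect r
        gap≡ : ∀ {r} → r ∈ filter P? A → r ∈ A × gap r ≡ L ∸ v
        gap≡ r∈ with ∈-filter⁻ P? {xs = A} r∈
        ... | r∈A , refl = r∈A , sym (ℕ.m∸[m∸n]≡n (gap≤L r∈A))
        -- To apply `few`, the length `L ∸ v` must be positive. This is read off an element of the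
        -- filtered list, hence the split on emptiness.
        bound : ∀ rs → filter P? A ≡ rs → length (filter P? A) ≤ g
        bound []      eq = subst (λ rs → length rs ≤ g) (sym eq) z≤n
        bound (r ∷ _) eq = few {L ∸ v}
          (subst (0 <_) (proj₂ (gap≡ (subst (r ∈_) (sym eq) (here refl)))) z<s)
          (ℕ.≤-<-trans (ℕ.m∸n≤m L v) L<M) (filter P? A) (Unique.filter⁺ P? distinct)
          λ {s} s∈ → proj₁ (gap≡ s∈) ,
            subst (λ t → (s + t) % M ∈ A) (proj₂ (gap≡ s∈)) (gap-∈ (proj₁ (gap≡ s∈)))

  -- Doubling `gap-sum-bound`, using `2(0 + … + (k - 1)) = k² - k`, and cancelling `k` gives
  -- `2gL + g ≥ 3gk + 2`, which is the bound `L ≥ (3p - 1 - g)/(2g)` with `p = gk + 1`.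
  wide-gap : ∀ {g k} .{{_ : NonZero g}} .{{_ : NonZero k}} .{{_ : NonZero (suc (g * k) * k)}} {A} →
    (golomb : IsModularGolomb g (suc (g * k) * k) A) → length A ≡ g * k → ∀ {r₀} → r₀ ∈ A →
    let open Gaps (suc (g * k) * k) A (IsModularGolomb.below golomb)
    in ∃ λ r → r ∈ A × 3 * (g * k) + 2 ≤ 2 * g * gap r + g
  wide-gap {g} {k} {A} golomb size r₀∈A = conclude (widest r₀∈A)
    where
    M = suc (g * k) * k
    open Gaps M A (IsModularGolomb.below golomb)
    open ℕ.≤-Reasoning

    -- The widest gap may have length `M`, where `gap-sum-bound` does not apply; `M` itself is then
    -- large enough.
    full : 3 * (g * k) + 2 ≤ 2 * g * M + g
    full = begin
      3 * (g * k) + 2                                   ≡⟨ split (g * k) ⟩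
      2 * (g * k) + 1 + (1 * (g * k) + 1)  ≤⟨ ℕ.+-mono-≤ (ℕ.+-monoʳ-≤ (2 * (g * k)) (ℕ.>-nonZero⁻¹ g))
         (ℕ.+-mono-≤ (ℕ.*-monoˡ-≤ (g * k) (ℕ.>-nonZero⁻¹ (g * k) {{ℕ.m*n≢0 g k}})) (ℕ.*-mono-≤ 0<gk 0<gk)) ⟩
      2 * (g * k) + g + (g * k * (g * k) + g * k * (g * k))  ≡⟨ join g k ⟩
      2 * g * M + g                                     ∎
      where
      0<gk : 0 < g * k
      0<gk = ℕ.>-nonZero⁻¹ (g * k) {{ℕ.m*n≢0 g k}}
      split : ∀ n → 3 * n + 2 ≡ 2 * n + 1 + (1 * n + 1)
      split = solveℕ-∀
      join : ∀ g k → 2 * (g * k) + g + (g * k * (g * k) + g * k * (g * k)) ≡ 2 * g * (suc (g * k) * k) + g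
      join = solveℕ-∀

    partial : ∀ L → g * triangular k + M ≤ g * k * L → 3 * (g * k) + 2 ≤ 2 * g * L + g
    partial L bound = ℕ.*-cancelʳ-≤ _ _ k (begin
      (3 * (g * k) + 2) * k                               ≡⟨ expand g k ⟩
      g * (k * k) + 2 * M                                 ≡⟨ cong (λ s → g * s + 2 * M) (triangular-double k) ⟨
      g * (2 * triangular k + k) + 2 * M                  ≡⟨ collect g (triangular k) k M ⟩
      2 * (g * triangular k + M) + g * k                  ≤⟨ ℕ.+-monoˡ-≤ (g * k) (ℕ.*-monoʳ-≤ 2 bound) ⟩
      2 * (g * k * L) + g * k                             ≡⟨ factor g k L ⟩
      (2 * g * L + g) * k                                 ∎)
      where
      expand : ∀ g k → (3 * (g * k) + 2) * k ≡ g * (k * k) + 2 * (suc (g * k) * k)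
      expand = solveℕ-∀
      collect : ∀ g t k M → g * (2 * t + k) + 2 * M ≡ 2 * (g * t + M) + g * k
      collect = solveℕ-∀
      factor : ∀ g k L → 2 * (g * k * L) + g * k ≡ (2 * g * L + g) * k
      factor = solveℕ-∀

    conclude : (∃ λ r → r ∈ A × (∀ {s} → s ∈ A → gap s ≤ gap r)) →
      ∃ λ r → r ∈ A × 3 * (g * k) + 2 ≤ 2 * g * gap r + g
    conclude (r , r∈A , gap≤) = r , r∈A , [
        (λ gap<M → partial (gap r) (gap-sum-bound golomb size r₀∈A gap<M gap≤)) ,
        (λ gap≡M → subst (λ L → 3 * (g * k) + 2 ≤ 2 * g * L + g) (sym gap≡M) full) ]′
      (ℕ.m≤n⇒m<n∨m≡n (gap≤M r))

open ModularGaps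

-- Cutting the circle at a gap to obtain an integer ruler.

module Cutting where
  open import Data.Integer.Base using (∣_∣; _+_; _*_; _-_; -_)
  open import Data.Nat.Base using (_∸_; _≤_; _<_; _%_)

  module _ {M : ℕ} .{{_ : NonZero M}} where

    %ℕ-≈ : ∀ a → + (a %ℕ M) ≈ a [mod M ]
    %ℕ-≈ a = ≈-sym (by (a /ℕ M) (a≡a%ℕn+[a/ℕn]*n a M))

    ≈⇒%≡ : ∀ {a b} → + a ≈ + b [mod M ] → a % M ≡ b % M
    ≈⇒%≡ {a} {b} a≈b = +-injective-mod (ℕ.m%n<n a M) (ℕ.m%n<n b M)
      (≈-trans (%ℕ-≈ (+ a)) (≈-trans a≈b (≈-sym (%ℕ-≈ (+ b)))))

    ≈-period : ∀ {a b} → a ≡ b ℕ.+ M → + a ≈ + b [mod M ]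
    ≈-period {b = b} refl = by 1ℤ (trans (ℤ.pos-+ b M) (cong (λ z → + b + z) (sym (ℤ.*-identityˡ (+ M)))))

  pairsAt-map⁻ : (f : ℕ → ℤ) → ∀ xs d {p} → p ∈ pairsAt d (map f xs) →
    ∃₂ λ x y → x ∈ xs × y ∈ xs × p ≡ (f x , f y) × f y - f x ≡ d
  pairsAt-map⁻ f xs d p∈
    with p∈prod , eq ← ∈-filter⁻ (λ (a , c) → (c - a) ℤ.≟ d)
           {xs = cartesianProduct (map f xs) (map f xs)} p∈
    with a∈ , c∈ ← ∈-cartesianProduct⁻ (map f xs) (map f xs) p∈prod
    with x , x∈ , refl ← ∈-map⁻ f a∈ | y , y∈ , refl ← ∈-map⁻ f c∈ = x , y , x∈ , y∈ , refl , eq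

  module Cut {g M : ℕ} .{{_ : NonZero M}} {A : List ℕ} (golomb : IsModularGolomb g M A)
             {r} (r∈A : r ∈ A) where
    open IsModularGolomb golomb using (few; below) renaming (distinct to A-distinct)
    open Gaps M A below

    L base : ℕ
    L = gap r
    base = r ℕ.+ L

    -- The forward distance from the mark at the far end of the chosen gap. That mark gets position
    -- 0, and `r`, where the gap begins, gets `M ∸ L`.
    position : ℕ → ℕ
    position x = (+ x - + base) %ℕ M

    position<M : ∀ x → position x < M
    position<M x = n%ℕd<d (+ x - + base) M

    position+base : ∀ x → + (position x ℕ.+ base) ≈ + x [mod M ]
    position+base x = begin
      + (position x ℕ.+ base)      ≡⟨ ℤ.pos-+ (position x) base ⟩
      + position x + + base        ≈⟨ +-cong (%ℕ-≈ (+ x - + base)) (≈-refl {a = + base}) ⟩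
      + x - + base + + base        ≡⟨ restore (+ x) (+ base) ⟩
      + x                          ∎
      where
      open SetoidReasoning (≈-setoid M)
      restore : ∀ a b → a - b + b ≡ a
      restore = solve-∀

    recover : ∀ {x} → x ∈ A → (position x ℕ.+ base) % M ≡ x
    recover {x} x∈A = trans (≈⇒%≡ (position+base x)) (ℕ.m<n⇒m%n≡m (below x∈A))

    position-injective : ∀ {x y} → x ∈ A → y ∈ A → position x ≡ position y → x ≡ y
    position-injective x∈A y∈A eq =
      trans (sym (recover x∈A)) (trans (cong (λ v → (v ℕ.+ base) % M) eq) (recover y∈A))

    position-unique : ∀ {v} x → v < M → + (v ℕ.+ base) ≈ + x [mod M ] → position x ≡ v
    position-unique {v} x v<M v+base≈x = +-injective-mod (position<M x) v<M (begin
      + position x                 ≈⟨ %ℕ-≈ (+ x - + base) ⟩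
      + x - + base                 ≈⟨ +-cong v+base≈x (≈-refl {a = - + base}) ⟨
      + (v ℕ.+ base) - + base      ≡⟨ cong (λ z → z - + base) (ℤ.pos-+ v base) ⟩
      + v + + base - + base        ≡⟨ cancel (+ v) (+ base) ⟩
      + v                          ∎)
      where
      open SetoidReasoning (≈-setoid M)
      cancel : ∀ a b → a + b - b ≡ a
      cancel = solve-∀

    position-first : position (base % M) ≡ 0
    position-first = position-unique (base % M) (ℕ.>-nonZero⁻¹ M) (≈-sym (%ℕ-≈ (+ base)))

    position-last : position r ≡ M ∸ L
    position-last = position-unique r (ℕ.∸-monoʳ-< z<s (gap≤M r)) (≈-period (begin
      M ∸ L ℕ.+ (r ℕ.+ L)   ≡⟨ swap (M ∸ L) r L ⟩
      r ℕ.+ (M ∸ L ℕ.+ L)   ≡⟨ cong (r ℕ.+_) (ℕ.m∸n+n≡m (gap≤M r)) ⟩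
      r ℕ.+ M               ∎))
      where
      open ≡-Reasoning
      swap : ∀ a b c → a ℕ.+ (b ℕ.+ c) ≡ b ℕ.+ (a ℕ.+ c)
      swap = solveℕ-∀

    -- A mark at a position beyond `M ∸ L` would lie at distance `u` from `r` with `0 < u < L`,
    -- strictly inside the gap.
    position≤ : ∀ {x} → x ∈ A → position x ≤ M ∸ L
    position≤ {x} x∈A = ℕ.≮⇒≥ λ M∸L<v → gap-∉ r {u} (0<u M∸L<v) (u<L M∸L<v)
      (subst (_∈ A) (trans (sym (ℕ.m<n⇒m%n≡m (below x∈A))) (≈⇒%≡ (r+u≈x M∸L<v))) x∈A)
      where
      v = position x
      u = v ∸ (M ∸ L)
      0<u : M ∸ L < v → 0 < u
      0<u = ℕ.m<n⇒0<n∸m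
      v≡ : M ∸ L < v → v ≡ u ℕ.+ (M ∸ L)
      v≡ M∸L<v = sym (ℕ.m∸n+n≡m (ℕ.<⇒≤ M∸L<v))
      u<L : M ∸ L < v → u < L
      u<L M∸L<v = ℕ.+-cancelʳ-< (M ∸ L) u L (
        subst₂ _<_ (v≡ M∸L<v) (sym (ℕ.m+[n∸m]≡n (gap≤M r))) (position<M x))
      r+u≈x : M ∸ L < v → + x ≈ + (r ℕ.+ u) [mod M ]
      r+u≈x M∸L<v = ≈-trans (≈-sym (position+base x)) (≈-period (begin
        v ℕ.+ (r ℕ.+ L)                  ≡⟨ cong (ℕ._+ (r ℕ.+ L)) (v≡ M∸L<v) ⟩
        u ℕ.+ (M ∸ L) ℕ.+ (r ℕ.+ L)      ≡⟨ regroup u (M ∸ L) r L ⟩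
        r ℕ.+ u ℕ.+ (M ∸ L ℕ.+ L)        ≡⟨ cong (r ℕ.+ u ℕ.+_) (ℕ.m∸n+n≡m (gap≤M r)) ⟩
        r ℕ.+ u ℕ.+ M                    ∎))
        where
        open ≡-Reasoning
        regroup : ∀ a b c d → a ℕ.+ b ℕ.+ (c ℕ.+ d) ≡ c ℕ.+ a ℕ.+ (b ℕ.+ d)
        regroup = solveℕ-∀

    marks : List ℤ
    marks = map (λ x → + position x) A

    marks-unique : Unique marks
    marks-unique = unique-map _
      (λ x∈A y∈A eq → position-injective x∈A y∈A (ℤ.+-injective eq)) A-distinct

    -- A pair at distance `t` is determined by its first mark. `first` turns that mark back into a
    -- residue, and both this residue and its shift by `t` lie in `A`, so the pairs inject into a
    -- list bounded by `few`.
    golomb-marks : IsGolomb g marks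
    golomb-marks (+ t) (ℤ.+<+ 0<t) = bound (pairsAt (+ t) marks) refl
      where
      first : ℤ × ℤ → ℕ
      first (a , c) = (∣ a ∣ ℕ.+ base) % M

      position-sum : ∀ {x y} → + position y - + position x ≡ + t → position y ≡ position x ℕ.+ t
      position-sum {x} {y} eq = ℤ.+-injective (begin
        + position y                                  ≡⟨ restore (+ position y) (+ position x) ⟩
        + position x + (+ position y - + position x)  ≡⟨ cong (λ z → + position x + z) eq ⟩
        + position x + + t                            ≡⟨ ℤ.pos-+ (position x) t ⟨
        + (position x ℕ.+ t)                          ∎)
        where
        open ≡-Reasoning
        restore : ∀ a b → a ≡ b + (a - b)
        restore = solve-∀

      +t≈ : ∀ {x y} → + position y - + position x ≡ + t → + (x ℕ.+ t) ≈ + y [mod M ]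
      +t≈ {x} {y} eq = begin
          + (x ℕ.+ t)                            ≡⟨ ℤ.pos-+ x t ⟩
          + x + + t                              ≈⟨ +-cong (position+base x) (≈-refl {a = + t}) ⟨
          + (position x ℕ.+ base) + + t          ≡⟨ ℤ.pos-+ (position x ℕ.+ base) t ⟨
          + (position x ℕ.+ base ℕ.+ t)          ≡⟨ cong +_ (swap (position x) base t) ⟩
          + (position x ℕ.+ t ℕ.+ base)          ≡⟨ cong (λ v → + (v ℕ.+ base)) (position-sum {x} {y} eq) ⟨
          + (position y ℕ.+ base)                ≈⟨ position+base y ⟩
          + y                                    ∎
          where
          open SetoidReasoning (≈-setoid M)
          swap : ∀ a b c → a ℕ.+ b ℕ.+ c ≡ a ℕ.+ c ℕ.+ b
          swap = solveℕ-∀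

      Pair : ℤ × ℤ → Set
      Pair p = ∃₂ λ x y → x ∈ A × y ∈ A ×
        p ≡ (+ position x , + position y) × + position y - + position x ≡ + t

      pair : ∀ {p} → p ∈ pairsAt (+ t) marks → Pair p
      pair = pairsAt-map⁻ (λ x → + position x) A (+ t)

      first-∈ : ∀ {p} → Pair p → first p ∈ A × (first p ℕ.+ t) % M ∈ A × t < M
      first-∈ (x , y , x∈A , y∈A , refl , eq) =
          subst (_∈ A) (sym (recover x∈A)) x∈A
        , subst (_∈ A) (sym (begin
            (first (+ position x , + position y) ℕ.+ t) % M ≡⟨ cong (λ z → (z ℕ.+ t) % M) (recover x∈A) ⟩
            (x ℕ.+ t) % M                                   ≡⟨ ≈⇒%≡ (+t≈ {x} {y} eq) ⟩
            y % M                                           ≡⟨ ℕ.m<n⇒m%n≡m (below y∈A) ⟩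
            y                                               ∎)) y∈A
        , ℕ.≤-<-trans (ℕ.m≤n+m t (position x)) (subst (_< M) (position-sum {x} {y} eq) (position<M y))
        where open ≡-Reasoning

      first-injective : ∀ {p q} → Pair p → Pair q → first p ≡ first q → p ≡ q
      first-injective (x , y , x∈A , y∈A , refl , x+t) (x′ , y′ , x′∈A , y′∈A , refl , x′+t) eq =
        same (trans (sym (recover x∈A)) (trans eq (recover x′∈A)))
        where
        same : x ≡ x′ → (+ position x , + position y) ≡ (+ position x′ , + position y′)
        same refl = cong (λ v → + position x , + v)
          (trans (position-sum {x} {y} x+t) (sym (position-sum {x} {y′} x′+t)))

      -- The requirement `t < M` of `few` follows from the existence of a pair, as all positions are
      -- below `M`; the empty list is settled separately.
      bound : ∀ ps → pairsAt (+ t) marks ≡ ps → length (pairsAt (+ t) marks) ≤ g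
      bound [] eq = subst (λ ps → length ps ≤ g) (sym eq) z≤n
      bound (p ∷ _) eq = subst (_≤ g) (List.length-map first (pairsAt (+ t) marks))
        (few 0<t (proj₂ (proj₂ (first-∈ (pair (subst (p ∈_) (sym eq) (here refl))))))
          (map first (pairsAt (+ t) marks))
          (unique-map first (λ p∈ q∈ → first-injective (pair p∈) (pair q∈))
            (Unique.filter⁺ _ (Unique.cartesianProduct⁺ marks-unique marks-unique)))
          λ r∈ → firsts (∈-map⁻ first r∈))
        where
        firsts : ∀ {r} → (∃ λ p → p ∈ pairsAt (+ t) marks × r ≡ first p) → r ∈ A × (r ℕ.+ t) % M ∈ A
        firsts (p , p∈ , refl) = proj₁ (first-∈ (pair p∈)) , proj₁ (proj₂ (first-∈ (pair p∈)))

    ruler : ∀ {n} → length A ≡ n → Ruler g n (M ∸ L)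
    ruler size = record
      { marks = marks
      ; distinct = marks-unique
      ; size = trans (List.length-map _ A) size
      ; golomb = golomb-marks
      ; diameter = record
        { smallest = 0ℤ ; largest = + (M ∸ L)
        ; smallest∈ = subst (λ v → + v ∈ marks) position-first (∈-map⁺ _ (gap-∈ r∈A))
        ; largest∈ = subst (λ v → + v ∈ marks) position-last (∈-map⁺ _ r∈A)
        ; smallest≤ = All.map⁺ (All.tabulate λ _ → ℤ.+≤+ z≤n)
        ; ≤largest = All.map⁺ (All.tabulate λ x∈A → ℤ.+≤+ (position≤ x∈A))
        ; difference = ℤ.+-identityʳ (+ (M ∸ L)) } }

open Cutting

-- Ruzsa's construction modulo `pk`.

module RuzsaRulers where
  open import Data.Integer.Base using (∣_∣; _+_; _*_; _-_; _^_)
  open import Data.Nat.Base using (_∸_; _≤_; _<_; _%_)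

  ∸-≈0⇒≈ : ∀ {m i j} → i ≤ j → m ℕ.∣ j ∸ i → + i ≈ + j [mod m ]
  ∸-≈0⇒≈ {m} {i} {j} i≤j m∣ = -≈0⇒≈ (∣⇒≈0 (subst (m ℕ.∣_)
    (sym (trans (cong ∣_∣ (ℤ.m-n≡m⊖n i j)) (ℤ.∣⊖∣-≤ i≤j))) m∣))

  ≈⇒∸-≈0 : ∀ {m i j} → i ≤ j → + i ≈ + j [mod m ] → m ℕ.∣ j ∸ i
  ≈⇒∸-≈0 {m} {i} {j} i≤j i≈j = subst (m ℕ.∣_)
    (trans (cong ∣_∣ (ℤ.m-n≡m⊖n i j)) (ℤ.∣⊖∣-≤ i≤j)) (≈0⇒∣ (≈⇒-≈0 i≈j))

  module _ {p : ℕ} (p-prime : Prime p) {θ : ℤ} {n : ℕ} .{{_ : NonZero n}}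
           (θ-order : HasOrder p θ n) where
    open HasOrder θ-order
    open SetoidReasoning (≈-setoid p)

    θ^≉0 : ∀ i → ¬ θ ^ i ≈ 0ℤ [mod p ]
    θ^≉0 i = ^-≉0 p-prime θ i (^≈1⇒≉0 p-prime θ n ^≈1)

    ^-split : ∀ {i j} → i ≤ j → θ ^ j ≡ θ ^ i * θ ^ (j ∸ i)
    ^-split {i} {j} i≤j = trans (cong (θ ^_) (sym (ℕ.m+[n∸m]≡n i≤j))) (ℤ.^-distribˡ-+-* θ i (j ∸ i))

    -- The power with the smaller exponent is invertible modulo `p` and cancels, leaving a power of
    -- `θ` equal to 1, whose exponent `n` divides. Together with `≈⇒^≈` this makes the discrete
    -- logarithm well defined modulo `n`.
    ^≈⇒≈ : ∀ i j → θ ^ i ≈ θ ^ j [mod p ] → + i ≈ + j [mod n ]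
    ^≈⇒≈ i j θⁱ≈θʲ = [ (λ i≤j → ordered i≤j θⁱ≈θʲ) ,
                         (λ j≤i → ≈-sym (ordered j≤i (≈-sym θⁱ≈θʲ))) ]′ (ℕ.≤-total i j)
      where
      ordered : ∀ {i j} → i ≤ j → θ ^ i ≈ θ ^ j [mod p ] → + i ≈ + j [mod n ]
      ordered {i} {j} i≤j θⁱ≈θʲ = ∸-≈0⇒≈ i≤j (order (j ∸ i) (*-cancelˡ-≈ p-prime (θ ^ i) (θ^≉0 i) (begin
        θ ^ i * θ ^ (j ∸ i)  ≡⟨ ^-split i≤j ⟨
        θ ^ j                ≈⟨ θⁱ≈θʲ ⟨
        θ ^ i                ≡⟨ ℤ.*-identityʳ (θ ^ i) ⟨
        θ ^ i * 1ℤ           ∎)))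

    ≈⇒^≈ : ∀ i j → + i ≈ + j [mod n ] → θ ^ i ≈ θ ^ j [mod p ]
    ≈⇒^≈ i j i≈j = [ (λ i≤j → ordered i≤j i≈j) ,
                       (λ j≤i → ≈-sym (ordered j≤i (≈-sym i≈j))) ]′ (ℕ.≤-total i j)
      where
      ordered : ∀ {i j} → i ≤ j → + i ≈ + j [mod n ] → θ ^ i ≈ θ ^ j [mod p ]
      ordered {i} {j} i≤j i≈j = begin
        θ ^ i                ≡⟨ ℤ.*-identityʳ (θ ^ i) ⟨
        θ ^ i * 1ℤ           ≈⟨ *-cong (≈-refl {a = θ ^ i}) (^-∣ θ n ^≈1 (≈⇒∸-≈0 i≤j i≈j)) ⟨
        θ ^ i * θ ^ (j ∸ i)  ≡⟨ ^-split i≤j ⟨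
        θ ^ j                ∎

  module Ruzsa {g k : ℕ} .{{_ : NonZero g}} .{{_ : NonZero k}}
               (p-prime : Prime (suc (g ℕ.* k))) {θ : ℤ}
               (θ-order : HasOrder (suc (g ℕ.* k)) θ (g ℕ.* k)) where

    n p M : ℕ
    n = g ℕ.* k
    p = suc n
    M = p ℕ.* k

    instance
      n≢0 : NonZero n
      n≢0 = ℕ.m*n≢0 g k
      M≢0 : NonZero M
      M≢0 = ℕ.m*n≢0 p k

    -- An explicit solution of the two congruences of the Chinese remainder theorem: since `n` is -1
    -- modulo `p`, the correction `(i - θ^i) n` turns `i` into `θ^i` there and vanishes modulo `n`.
    lift : ℕ → ℤ
    lift i = + i + (+ i - θ ^ i) * + n

    lift≈i : ∀ i → lift i ≈ + i [mod n ]
    lift≈i i = by (+ i - θ ^ i) refl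

    lift≈θ^i : ∀ i → lift i ≈ θ ^ i [mod p ]
    lift≈θ^i i = by (+ i - θ ^ i) (identity (+ i) (θ ^ i) (+ n))
      where
      identity : ∀ i x n → i + (i - x) * n ≡ x + (i - x) * (1ℤ + n)
      identity = solve-∀

    residue : ℕ → ℕ
    residue i = lift i %ℕ M

    residue≈ : ∀ i → + residue i ≈ lift i [mod M ]
    residue≈ i = %ℕ-≈ (lift i)

    p∣M : p ℕ.∣ M
    p∣M = ℕ.m∣m*n k

    -- Reduction modulo `pk` preserves the class modulo `p`, and `θ^i` modulo `p` already determines
    -- `i` below `n`.
    residue-injective : ∀ {i j} → i < n → j < n → residue i ≡ residue j → i ≡ j
    residue-injective {i} {j} i<n j<n eq = +-injective-mod i<n j<n (^≈⇒≈ p-prime θ-order i j (begin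
      θ ^ i         ≈⟨ lift≈θ^i i ⟨
      lift i        ≈⟨ ≈-weaken p∣M (residue≈ i) ⟨
      + residue i   ≡⟨ cong +_ eq ⟩
      + residue j   ≈⟨ ≈-weaken p∣M (residue≈ j) ⟩
      lift j        ≈⟨ lift≈θ^i j ⟩
      θ ^ j         ∎))
      where open SetoidReasoning (≈-setoid p)

    residues : List ℕ
    residues = applyUpTo residue n

    -- A representation of t as a difference of lifts is labelled by the exponent
    -- difference j - i, which is only known mod k: this leaves g possible labels.
    Difference : ℕ → ℕ → Fin g → Set
    Difference t r s = ∃₂ λ i j → i < n × j < n × r ≡ residue i ×
      lift i + + t ≈ lift j [mod M ] × + j ≈ + i + + t + + toℕ s * + k [mod n ]

    labelled : ∀ {t i j} → i < n → j < n → lift i + + t ≈ lift j [mod M ] → ∃ (Difference t (residue i))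
    labelled {t} {i} {j} i<n j<n eq = label j≈i+t
      where
      open SetoidReasoning (≈-setoid k)
      j≈i+t : + j ≈ + i + + t [mod k ]
      j≈i+t = begin
        + j             ≈⟨ ≈-weaken (ℕ.n∣m*n g) (lift≈i j) ⟨
        lift j          ≈⟨ ≈-weaken (ℕ.n∣m*n p) eq ⟨
        lift i + + t    ≈⟨ +-cong (≈-weaken (ℕ.n∣m*n g) (lift≈i i)) (≈-refl {a = + t}) ⟩
        + i + + t       ∎

      label : + j ≈ + i + + t [mod k ] → ∃ (Difference t (residue i))
      -- Here `j = i + t + qk`. Writing `q = s + g q′` turns the excess into `sk` plus a multiple of
      -- `gk = n`, so the residue `s` of `q` modulo `g` is the label.
      label (by q j≡) = fromℕ< (n%ℕd<d q g) , i , j , i<n , j<n , refl , eq , by (q /ℕ g) (trans j≡ (trans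
        (cong (λ z → + i + + t + z * + k) (a≡a%ℕn+[a/ℕn]*n q g)) (trans
        (regroup (+ i + + t) (+ (q %ℕ g)) (q /ℕ g) (+ g) (+ k))
        (cong₂ (λ s n → + i + + t + + s * + k + q /ℕ g * n)
          (sym (Fin.toℕ-fromℕ< (n%ℕd<d q g))) (sym (ℤ.pos-* g k))))))
        where
        regroup : ∀ a s q g k → a + (s + q * g) * k ≡ a + s * k + q * (g * k)
        regroup = solve-∀

    -- Equal labels give `j′ + i` and `j + i′` congruent modulo `n`, hence `θ^j′ θ^i` and `θ^j θ^i′`
    -- congruent modulo `p`. Substituting `θ^j = θ^i + t` and `θ^j′ = θ^i′ + t` and cancelling the
    -- common product leaves `t (θ^i - θ^i′)` congruent to 0.
    same-label : ∀ {t} → 0 < t → t < M → ∀ {r r′ s} → Difference t r s → Difference t r′ s → r ≡ r′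
    same-label {t} 0<t t<M {s = s}
      (i , j , i<n , j<n , refl , lifts , label) (i′ , j′ , i′<n , j′<n , refl , lifts′ , label′) =
      cong residue ([ (λ t≈0 → contradiction t≈0 t≉0) , same-i ]′
        (*≈0⇒≈0 p-prime (+ t) (θ ^ i - θ ^ i′)
          (≈-trans (≈-reflexive (factor (+ t) (θ ^ i) (θ ^ i′))) (≈⇒-≈0 cross))))
      where
      factor : ∀ t x y → t * (x - y) ≡ (y + t) * x - (x + t) * y
      factor = solve-∀

      θ-step : ∀ i j → lift i + + t ≈ lift j [mod M ] → θ ^ i + + t ≈ θ ^ j [mod p ]
      θ-step i j eq = begin
        θ ^ i + + t      ≈⟨ +-cong (lift≈θ^i i) (≈-refl {a = + t}) ⟨
        lift i + + t     ≈⟨ ≈-weaken p∣M eq ⟩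
        lift j           ≈⟨ lift≈θ^i j ⟩
        θ ^ j            ∎
        where open SetoidReasoning (≈-setoid p)

      exponents : + (j′ ℕ.+ i) ≈ + (j ℕ.+ i′) [mod n ]
      exponents = begin
        + (j′ ℕ.+ i)             ≡⟨ ℤ.pos-+ j′ i ⟩
        + j′ + + i               ≈⟨ +-cong label′ (≈-refl {a = + i}) ⟩
        + i′ + + t + c + + i     ≡⟨ swap (+ i′) (+ i) (+ t) c ⟩
        + i + + t + c + + i′     ≈⟨ +-cong label (≈-refl {a = + i′}) ⟨
        + j + + i′               ≡⟨ ℤ.pos-+ j i′ ⟨
        + (j ℕ.+ i′)             ∎
        where
        open SetoidReasoning (≈-setoid n)
        c = + toℕ s * + k
        swap : ∀ a b t c → a + t + c + b ≡ b + t + c + a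
        swap = solve-∀

      open SetoidReasoning (≈-setoid p)

      cross : (θ ^ i′ + + t) * θ ^ i ≈ (θ ^ i + + t) * θ ^ i′ [mod p ]
      cross = begin
        (θ ^ i′ + + t) * θ ^ i   ≈⟨ *-cong (θ-step i′ j′ lifts′) (≈-refl {a = θ ^ i}) ⟩
        θ ^ j′ * θ ^ i           ≡⟨ ℤ.^-distribˡ-+-* θ j′ i ⟨
        θ ^ (j′ ℕ.+ i)           ≈⟨ ≈⇒^≈ p-prime θ-order (j′ ℕ.+ i) (j ℕ.+ i′) exponents ⟩
        θ ^ (j ℕ.+ i′)           ≡⟨ ℤ.^-distribˡ-+-* θ j i′ ⟩
        θ ^ j * θ ^ i′           ≈⟨ *-cong (θ-step i j lifts) (≈-refl {a = θ ^ i′}) ⟨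
        (θ ^ i + + t) * θ ^ i′   ∎

      same-i : θ ^ i - θ ^ i′ ≈ 0ℤ [mod p ] → i ≡ i′
      same-i θⁱ-θⁱ′≈0 = +-injective-mod i<n i′<n (^≈⇒≈ p-prime θ-order i i′ (-≈0⇒≈ θⁱ-θⁱ′≈0))

      -- If `p` divided `t`, then `θ^i` and `θ^j` would agree modulo `p`, so `i = j`; the two lifts
      -- would coincide and `M` would divide `t`, contrary to `0 < t < M`.
      t≉0 : ¬ + t ≈ 0ℤ [mod p ]
      t≉0 t≈0 = ℕ.<⇒≢ 0<t (sym (+-injective-mod t<M (ℕ.<-trans 0<t t<M) t≈0-mod-M))
        where
        i≡j : i ≡ j
        i≡j = +-injective-mod i<n j<n (^≈⇒≈ p-prime θ-order i j (begin
          θ ^ i          ≡⟨ ℤ.+-identityʳ (θ ^ i) ⟨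
          θ ^ i + 0ℤ     ≈⟨ +-cong (≈-refl {a = θ ^ i}) t≈0 ⟨
          θ ^ i + + t    ≈⟨ θ-step i j lifts ⟩
          θ ^ j          ∎))

        t≈0-mod-M : + t ≈ 0ℤ [mod M ]
        t≈0-mod-M = ≈-trans (≈-reflexive (cancel (lift i) (+ t)))
          (≈⇒-≈0 (subst (λ j → lift i + + t ≈ lift j [mod M ]) (sym i≡j) lifts))
          where
          cancel : ∀ a t → t ≡ a + t - a
          cancel = solve-∀

    residues-golomb : IsModularGolomb g M residues
    residues-golomb = record
      { distinct = Unique.applyUpTo⁺₁ residue n λ i<j j<n eq →
          ℕ.<⇒≢ i<j (residue-injective (ℕ.<-trans i<j j<n) j<n eq)
      ; below = λ r∈ → residue< (∈-applyUpTo⁻ residue r∈)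
      ; few = λ {t} 0<t t<M rs unique shifts → length≤-by-labels (Difference t) unique
          (λ r∈ → difference (∈-applyUpTo⁻ residue (proj₁ (shifts r∈)))
                             (∈-applyUpTo⁻ residue (proj₂ (shifts r∈))))
          (λ {_} {_} {s} → same-label 0<t t<M {s = s}) }
      where
      residue< : ∀ {r} → (∃ λ i → i < n × r ≡ residue i) → r < M
      residue< (i , _ , refl) = n%ℕd<d (lift i) M

      difference : ∀ {r t} → (∃ λ i → i < n × r ≡ residue i) →
        (∃ λ j → j < n × (r ℕ.+ t) % M ≡ residue j) → ∃ (Difference t r)
      difference {t = t} (i , i<n , refl) (j , j<n , eq) = labelled i<n j<n (begin
        lift i + + t                     ≈⟨ +-cong (residue≈ i) (≈-refl {a = + t}) ⟨
        + residue i + + t                ≡⟨ ℤ.pos-+ (residue i) t ⟨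
        + (residue i ℕ.+ t)              ≈⟨ %ℕ-≈ (+ (residue i ℕ.+ t)) ⟨
        + ((residue i ℕ.+ t) % M)        ≡⟨ cong +_ eq ⟩
        + residue j                      ≈⟨ residue≈ j ⟩
        lift j                           ∎)
        where open SetoidReasoning (≈-setoid M)

    residue₀∈ : residue 0 ∈ residues
    residue₀∈ = ∈-applyUpTo⁺ residue (ℕ.>-nonZero⁻¹ n)

    short-ruler : ∃ λ L → L ≤ M × 3 ℕ.* n ℕ.+ 2 ≤ 2 ℕ.* g ℕ.* L ℕ.+ g × Ruler g n (M ∸ L)
    short-ruler = cut (wide-gap residues-golomb (List.length-applyUpTo residue n) residue₀∈)
      where
      open Gaps M residues (IsModularGolomb.below residues-golomb)
      cut : (∃ λ r → r ∈ residues × 3 ℕ.* n ℕ.+ 2 ≤ 2 ℕ.* g ℕ.* gap r ℕ.+ g) →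
        ∃ λ L → L ≤ M × 3 ℕ.* n ℕ.+ 2 ≤ 2 ℕ.* g ℕ.* L ℕ.+ g × Ruler g n (M ∸ L)
      cut (r , r∈ , wide) = gap r , gap≤M r , wide ,
        Cut.ruler residues-golomb r∈ (List.length-applyUpTo residue n)

open RuzsaRulers

-- Order properties of fractions, floor and ceiling.

module Rationals where
  open import Data.Rational.Base using (_/_; _+_; _-_; -_; _≤_; floor; ceiling; ↥_; ↧_; toℚᵘ)

  floor-greatest : ∀ q i → i ℤ.* ↧ q ℤ.≤ ↥ q → i ℤ.≤ floor q
  floor-greatest q@record{} i i↧≤↥ = subst (i ℤ.≤_)
    (trans (ℤ.pred-suc (↥ q ℤ./ℕ ℚ.↧ₙ q)) (sym (ℤ.div-pos-is-/ℕ (↥ q) (ℚ.↧ₙ q))))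
    (ℤ.i<j⇒i≤pred[j] i<1+q)
    where
    i<1+q : i ℤ.< ℤ.suc (↥ q ℤ./ℕ ℚ.↧ₙ q)
    i<1+q = ℤ.*-cancelʳ-<-nonNeg (↧ q) (ℤ.≤-<-trans i↧≤↥ (ℤ.n<s[n/ℕd]*d (↥ q) (ℚ.↧ₙ q)))

  -- Building a normalised fraction cancels common factors and hides the given numerator and
  -- denominator. Among unnormalised rationals they stay visible, and inequalities become
  -- cross-multiplied integer inequalities.
  toℚᵘ-/ : ∀ i n .{{_ : NonZero n}} → toℚᵘ (i / n) ≃ i ℚᵘ./ n
  toℚᵘ-/ i (suc n) = ℚ.toℚᵘ-fromℚᵘ (mkℚᵘ i n)

  /-mono-≤ : ∀ i m j n .{{_ : NonZero m}} .{{_ : NonZero n}} → i ℤ.* + n ℤ.≤ j ℤ.* + m → i / m ≤ j / n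
  /-mono-≤ i (suc m) j (suc n) in≤jm = ℚ.toℚᵘ-cancel-≤
    (ℚᵘ.≤-respˡ-≃ (ℚᵘ.≃-sym (toℚᵘ-/ i (suc m))) (ℚᵘ.≤-respʳ-≃ (ℚᵘ.≃-sym (toℚᵘ-/ j (suc n))) (*≤* in≤jm)))

  ≤/1⇒↥≤ : ∀ q i → q ≤ i / 1 → ↥ q ℤ.≤ i ℤ.* ↧ q
  ≤/1⇒↥≤ q@record{} i q≤i with *≤* ↥≤ ← ℚᵘ.≤-respʳ-≃ (toℚᵘ-/ i 1) (ℚ.toℚᵘ-mono-≤ q≤i) =
    subst (ℤ._≤ i ℤ.* ↧ q) (ℤ.*-identityʳ (↥ q)) ↥≤

  -- The ceiling is the negated floor of `- q`, so this is `floor-greatest` with all signs reversed.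
  ceiling-least : ∀ q i → q ≤ i / 1 → ceiling q ℤ.≤ i
  ceiling-least q@record{} i q≤i = subst (ℤ.- floor (- q) ℤ.≤_) (ℤ.neg-involutive i)
    (ℤ.neg-mono-≤ (floor-greatest (- q) (ℤ.- i) (subst₂ ℤ._≤_
      (trans (ℤ.neg-distribˡ-* i (↧ q)) (cong (ℤ.- i ℤ.*_) (sym (ℚ.↧-neg q))))
      (sym (ℚ.↥-neg q))
      (ℤ.neg-mono-≤ (≤/1⇒↥≤ q i q≤i)))))

  /-+ : ∀ i m j n .{{_ : NonZero m}} .{{_ : NonZero n}} →
    toℚᵘ (i / m + j / n) ≃ i ℚᵘ./ m ℚᵘ.+ j ℚᵘ./ n
  /-+ i m j n = ℚᵘ.≃-trans (ℚ.toℚᵘ-homo-+ (i / m) (j / n)) (ℚᵘ.+-cong (toℚᵘ-/ i m) (toℚᵘ-/ j n))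

  /1+/1≤ : ∀ i j k n .{{_ : NonZero n}} → (i ℤ.+ j) ℤ.* + n ℤ.≤ k → i / 1 + j / 1 ≤ k / n
  /1+/1≤ i j k (suc n) ≤k = ℚ.toℚᵘ-cancel-≤
    (ℚᵘ.≤-respˡ-≃ (ℚᵘ.≃-sym (/-+ i 1 j 1)) (ℚᵘ.≤-respʳ-≃ (ℚᵘ.≃-sym (toℚᵘ-/ k (suc n)))
      (*≤* (subst₂ ℤ._≤_
        (cong (ℤ._* + suc n) (sym (cong₂ ℤ._+_ (ℤ.*-identityʳ i) (ℤ.*-identityʳ j))))
        (sym (ℤ.*-identityʳ k)) ≤k))))

  /≤/1+/ : ∀ i j k n .{{_ : NonZero n}} → i ℤ.≤ j ℤ.* + n ℤ.+ k → i / n ≤ j / 1 + k / n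
  /≤/1+/ i j k (suc n) i≤ = ℚ.toℚᵘ-cancel-≤
    (ℚᵘ.≤-respˡ-≃ (ℚᵘ.≃-sym (toℚᵘ-/ i (suc n))) (ℚᵘ.≤-respʳ-≃ (ℚᵘ.≃-sym (/-+ j 1 k (suc n)))
      (*≤* (subst₂ ℤ._≤_
        (cong (λ d → i ℤ.* + d) (sym (ℕ.*-identityˡ (suc n))))
        (cong (λ z → (j ℤ.* + suc n ℤ.+ z) ℤ.* + suc n) (sym (ℤ.*-identityʳ k)))
        (ℤ.*-monoʳ-≤-nonNeg (+ suc n) i≤)))))

  +-≤⇒≤- : ∀ {x y z} → x + y ≤ z → x ≤ z - y
  +-≤⇒≤- {x} {y} {z} x+y≤z = begin
    x              ≡⟨ ℚ.+-identityʳ x ⟨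
    x + ℚ.0ℚ       ≡⟨ cong (λ z → x + z) (ℚ.+-inverseʳ y) ⟨
    x + (y - y)    ≡⟨ ℚ.+-assoc x y (- y) ⟨
    x + y - y      ≤⟨ ℚ.+-monoˡ-≤ (- y) x+y≤z ⟩
    z - y          ∎
    where open ℚ.≤-Reasoning

open Rationals

-- Assembly of the two bounds on `G`.

open import Data.Nat.Base using (ℕ; NonZero; _*_; _∸_)
open import Data.Nat.Divisibility using (_∣_; _∤_)
open import Data.Nat.Primality using (Prime)
open import Data.Nat.Properties using (m*n≢0)
open import Data.Integer.Base as ℤ using (+_; 1ℤ)
open import Data.Rational.Base using (ℚ; _/_; _+_; _-_; _≤_; ∣_∣; ceiling)
open import Data.Product.Base using (_×_; ∃)

-- A division-free form of `d = p(p - 1)/g - L` with `L ≥ (3p - 1 - g)/(2g)`, from which both the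
-- exact and the asymptotic bound are derived.
short-ruler-of-prime : ∀ g p .{{_ : NonZero g}} (p-prime : Prime p) → g ∣ p ∸ 1 →
  ∃ λ L → ∃ λ d → Ruler g (p ∸ 1) d × g * (d ℕ.+ L) ≡ p * (p ∸ 1) × 3 * p ℕ.≤ 2 * g * L ℕ.+ (g ℕ.+ 1)
short-ruler-of-prime g (suc n) p-prime (ℕ.divides k n≡kg) =
  subst Bound (sym n≡gk) (bound (subst (λ n → Prime (suc n)) n≡gk p-prime))
  where
  n≡gk : n ≡ g * k
  n≡gk = trans n≡kg (ℕ.*-comm k g)

  instance
    n≢0 : NonZero n
    n≢0 = prime⇒p∸1≢0 p-prime
    gk≢0 : NonZero (g * k)
    gk≢0 = subst NonZero n≡gk n≢0
    k≢0 : NonZero k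
    k≢0 = ℕ.m*n≢0⇒n≢0 g

  Bound : ℕ → Set
  Bound n = ∃ λ L → ∃ λ d → Ruler g n d × g * (d ℕ.+ L) ≡ suc n * n ×
    3 * suc n ℕ.≤ 2 * g * L ℕ.+ (g ℕ.+ 1)

  bound : Prime (suc (g * k)) → Bound (g * k)
  bound p-prime = build (element-of-order p-prime (g * k) ℕ.∣-refl)
    where
    build : (∃ λ θ → HasOrder (suc (g * k)) θ (g * k)) → Bound (g * k)
    build (θ , θ-order) = rescale (Ruzsa.short-ruler {g} {k} p-prime θ-order)
      where
      M = suc (g * k) * k
      rescale : (∃ λ L → L ℕ.≤ M × 3 * (g * k) ℕ.+ 2 ℕ.≤ 2 * g * L ℕ.+ g ×
        Ruler g (g * k) (M ∸ L)) → Bound (g * k)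
      rescale (L , L≤M , wide , ruler) = L , M ∸ L , ruler
        , trans (cong (g *_) (ℕ.m∸n+n≡m L≤M)) (area g k)
        , subst₂ ℕ._≤_ (shift (g * k)) (ℕ.+-assoc (2 * g * L) g 1) (ℕ.+-monoˡ-≤ 1 wide)
        where
        area : ∀ g k → g * (suc (g * k) * k) ≡ suc (g * k) * (g * k)
        area = solveℕ-∀
        shift : ∀ n → 3 * n ℕ.+ 2 ℕ.+ 1 ≡ 3 * suc n
        shift = solveℕ-∀

module _ (p g : ℕ) .{{_ : NonZero g}} (p-prime : Prime p) (g∣p∸1 : g ∣ p ∸ 1) where
  private instance
    p∸1≢0 = prime⇒p∸1≢0 p-prime
    2g≢0  = m*n≢0 2 g

  minimal-diameter : ∃ λ L → g * (G g (p ∸ 1) ℕ.+ L) ℕ.≤ p * (p ∸ 1) × 3 * p ℕ.≤ 2 * g * L ℕ.+ (g ℕ.+ 1)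
  minimal-diameter = minimal (short-ruler-of-prime g p p-prime g∣p∸1)
    where
    minimal : (∃ λ L → ∃ λ d → Ruler g (p ∸ 1) d × g * (d ℕ.+ L) ≡ p * (p ∸ 1) ×
        3 * p ℕ.≤ 2 * g * L ℕ.+ (g ℕ.+ 1)) →
      ∃ λ L → g * (G g (p ∸ 1) ℕ.+ L) ℕ.≤ p * (p ∸ 1) × 3 * p ℕ.≤ 2 * g * L ℕ.+ (g ℕ.+ 1)
    minimal (L , d , ruler , area , wide) = L
      , ℕ.≤-trans (ℕ.*-monoʳ-≤ g (ℕ.+-monoˡ-≤ L (proj₂ (G-isMinimumDiameter g (p ∸ 1)) d ruler)))
          (ℕ.≤-reflexive area)
      , wide

  G+gap≤ : ∀ {L} → g * (G g (p ∸ 1) ℕ.+ L) ℕ.≤ p * (p ∸ 1) →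
    + G g (p ∸ 1) / 1 + + L / 1 ≤ + (p * (p ∸ 1)) / g
  G+gap≤ {L} area = /1+/1≤ (+ G g (p ∸ 1)) (+ L) (+ (p * (p ∸ 1))) g
    (subst (ℤ._≤ + (p * (p ∸ 1))) (ℤ.pos-* (G g (p ∸ 1) ℕ.+ L) g)
      (ℤ.+≤+ (subst (ℕ._≤ p * (p ∸ 1)) (ℕ.*-comm g (G g (p ∸ 1) ℕ.+ L)) area)))

  wideℤ : ∀ {L} → 3 * p ℕ.≤ 2 * g * L ℕ.+ (g ℕ.+ 1) →
    + (3 * p) ℤ.≤ + L ℤ.* + (2 * g) ℤ.+ + (g ℕ.+ 1)
  wideℤ {L} wide = subst (+ (3 * p) ℤ.≤_)
    (cong (λ z → z ℤ.+ + (g ℕ.+ 1)) (trans (cong +_ (ℕ.*-comm (2 * g) L)) (ℤ.pos-* L (2 * g)))) (ℤ.+≤+ wide)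

  -- The gap `L` is an integer, so a rational lower bound for it may be rounded up.
  exact-bound : + G g (p ∸ 1) / 1 ≤ + (p * (p ∸ 1)) / g
    - ceiling ((+ (3 * p) ℤ.- 1ℤ ℤ.- + g) / (2 * g)) / 1
  exact-bound = from minimal-diameter
    where
    x = (+ (3 * p) ℤ.- 1ℤ ℤ.- + g) / (2 * g)
    from : (∃ λ L → g * (G g (p ∸ 1) ℕ.+ L) ℕ.≤ p * (p ∸ 1) × 3 * p ℕ.≤ 2 * g * L ℕ.+ (g ℕ.+ 1)) →
      + G g (p ∸ 1) / 1 ≤ + (p * (p ∸ 1)) / g - ceiling x / 1
    from (L , area , wide) = +-≤⇒≤- (ℚ.≤-trans
      (ℚ.+-monoʳ-≤ (+ G g (p ∸ 1) / 1) (/-mono-≤ (ceiling x) 1 (+ L) 1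
        (ℤ.*-monoʳ-≤-nonNeg 1ℤ (ceiling-least x (+ L)
          (/-mono-≤ (+ (3 * p) ℤ.- 1ℤ ℤ.- + g) (2 * g) (+ L) 1 x≤L)))))
      (G+gap≤ area))
      where
      x≤L : (+ (3 * p) ℤ.- 1ℤ ℤ.- + g) ℤ.* 1ℤ ℤ.≤ + L ℤ.* + (2 * g)
      x≤L = subst₂ ℤ._≤_ (left (+ (3 * p)) (+ g)) (right (+ L ℤ.* + (2 * g)) (+ g))
        (ℤ.+-monoˡ-≤ (ℤ.- (+ g ℤ.+ 1ℤ)) (wideℤ wide))
        where
        left : ∀ a g → a ℤ.+ ℤ.- (g ℤ.+ 1ℤ) ≡ (a ℤ.- 1ℤ ℤ.- g) ℤ.* 1ℤ
        left = solve-∀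
        right : ∀ a g → a ℤ.+ (g ℤ.+ 1ℤ) ℤ.+ ℤ.- (g ℤ.+ 1ℤ) ≡ a
        right = solve-∀

  linear-bound : + G g (p ∸ 1) / 1 ≤ + (p * (p ∸ 1)) / g - + (3 * p) / (2 * g) + + (g ℕ.+ 1) / (2 * g)
  linear-bound = from minimal-diameter
    where
    Γ = + G g (p ∸ 1) / 1
    P = + (p * (p ∸ 1)) / g
    T = + (3 * p) / (2 * g)
    E = + (g ℕ.+ 1) / (2 * g)
    from : (∃ λ L → g * (G g (p ∸ 1) ℕ.+ L) ℕ.≤ p * (p ∸ 1) × 3 * p ℕ.≤ 2 * g * L ℕ.+ (g ℕ.+ 1)) →
      Γ ≤ P - T + E
    from (L , area , wide) = subst (Γ ≤_) (swap P E T) (+-≤⇒≤- (begin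
      Γ + T                   ≤⟨ ℚ.+-monoʳ-≤ Γ
                                   (/≤/1+/ (+ (3 * p)) (+ L) (+ (g ℕ.+ 1)) (2 * g) (wideℤ wide)) ⟩
      Γ + (+ L / 1 + E)       ≡⟨ ℚ.+-assoc Γ (+ L / 1) E ⟨
      Γ + + L / 1 + E         ≤⟨ ℚ.+-monoˡ-≤ E (G+gap≤ area) ⟩
      P + E                   ∎))
      where
      open ℚ.≤-Reasoning
      swap : ∀ a b c → a + b - c ≡ a - c + b
      swap a b c = trans (ℚ.+-assoc a b (ℚ.- c)) (trans
        (cong (λ z → a + z) (ℚ.+-comm b (ℚ.- c))) (sym (ℚ.+-assoc a (ℚ.- c) b)))

corollary9 :
    (∀ (p g : ℕ) .{{_ : NonZero g}} (p-prime : Prime p) → 2 ∤ p → g ∣ p ∸ 1 →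
      let instance
            p∸1≢0 = prime⇒p∸1≢0 p-prime
            2g≢0  = m*n≢0 2 g
      in + G g (p ∸ 1) / 1
           ≤ + (p * (p ∸ 1)) / g
             - ceiling ((+ (3 * p) ℤ.- 1ℤ ℤ.- + g) / (2 * g)) / 1)
    ×
    (∀ (g : ℕ) .{{_ : NonZero g}} →
      ∃ λ (C : ℚ) → (∀ (p : ℕ) (p-prime : Prime p) → 2 ∤ p → g ∣ p ∸ 1 →
        let instance
              p∸1≢0 = prime⇒p∸1≢0 p-prime
              2g≢0  = m*n≢0 2 g
        in ∃ λ (E : ℚ) → (∣ E ∣ ≤ C ×
             + G g (p ∸ 1) / 1
               ≤ + (p * (p ∸ 1)) / g - + (3 * p) / (2 * g) + E)))
corollary9 = (λ p g p-prime _ g∣p∸1 → exact-bound p g p-prime g∣p∸1) , λ g →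
  let instance 2g≢0 = m*n≢0 2 g
      -- Since `(3p - 1 - g)/(2g) = 3p/(2g) - (g + 1)/(2g)`, the error can be taken to be the same
      -- number for every `p`, and its absolute value is the constant.
      E = + (g ℕ.+ 1) / (2 * g)
  in ∣ E ∣ , λ p p-prime _ g∣p∸1 → E , ℚ.≤-refl , linear-bound p g p-prime g∣p∸1
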